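{- Let $D$ be a rank $k$ partial flag positroid pipe dream whose pivot columns satisfy $u_i<u_{i+1}$ for some $1\le i\le k-1$, and let $D'=\mathrm{st}_i(D)$. Then $\mathcal B(D)=\mathcal B(D')$.
   Context: Pipe dreams: for $u\in\mathfrak S_n$ use an $n\times n$ array, box $(i,j)$ in row $i$ from the top, column $j$ from the left, tiled by: empty; horizontal pipe; vertical pipe; pivot elbow (one arc from top-edge midpoint to right-edge midpoint); cross; elbow (two arcs: top to right, and left to bottom). A Rothe pipe dream of $u$: (i) $n$ pipes each from the top edge to the right edge; (ii) $(i,u_i)$ is a pivot elbow; (iii) boxes $(i,j)$ with $u^{ -1}(j)<i$, $j<u_i$ empty; (iv) boxes with $u^{ -1}(j)<i$, $j>u_i$ horizontal pipes; (v) boxes with $u^{ -1}(j)>i$, $j<u_i$ vertical pipes; remaining boxes crosses or elbows. Reduced: no two pipes cross twice. Exit permutation $v$: $v_i$ = label (starting column) of the pipe leaving the right edge in row $i$. Pipes touch if they share an elbow tile. A flag positroid pipe dream $\mathrm{FPP}(u,v)$ is a reduced Rothe pipe dream of $u$ with exit permutation $v$ in which two pipes that cross never touch southeast of their crossing. A rank $k$ partial flag positroid pipe dream is the restriction of some $n\times n$ flag positroid pipe dream to its first $k$ rows; its pivot columns are $u_1,\dots,u_k$. Directed graph $G(D)$: a source $s_{u_i}$ at each pivot elbow $(i,u_i)$, a vertex at each (non-pivot) elbow tile, and a sink $t_j$ above each column $j$; each non-sink vertex has an edge to the nearest vertex above it in its column (or to $t_j$ if none); each non-source vertex has an edge into it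 from the nearest vertex to its left in its row. An admissible $k$-collection is a set of $k$ pairwise vertex-disjoint directed paths each from a source to a sink; $\mathcal B(D)$ is the set of $J\subseteq[n]$, $|J|=k$, that are the sink sets $\{j: t_j\text{ is an endpoint}\}$ of admissible $k$-collections. Standardization $\mathrm{st}_i$ ($u_i<u_{i+1}$): with $D_{i,j}$ the tile in box $(i,j)$, let $j^*$ be the smallest $j\ge u_{i+1}$ with $D_{i,j}$ a cross and $D_{i+1,j}$ an elbow or pivot elbow ($j^*=\infty$ if none); $\mathrm{st}_i(D)$ is obtained by exchanging the tiles of rows $i$ and $i+1$ in all columns $j$ with $j\le u_{i+1}$ or $j\ge j^*$, then replacing box $(i,u_i)$ by a vertical pipe, box $(i+1,u_{i+1})$ by a horizontal pipe, and, if $u_{i+1}<j^*\le n$, box $(i+1,j^*)$ by an elbow; all other tiles unchanged. -}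

module Defs where

-- Conventions: rows and columns are 0-based natural numbers.  The n×n array
-- occupies boxes (i , j) with i < n, j < n; row 0 is the top row, column 0
-- the leftmost column.  Paper row/column r (1-based) is our r - 1.

open import Data.Nat using (ℕ; zero; suc; pred; _<_; _≤_; _∸_; _≡ᵇ_; _<ᵇ_; _≤ᵇ_)
open import Data.Bool using (Bool; true; false; _∧_; _∨_; if_then_else_)
open import Data.Maybe using (Maybe; just; nothing; maybe′)
open import Data.Product using (Σ; ∃; _×_; _,_)
open import Data.Sum using (_⊎_)
open import Data.List using (List; []; _∷_)
open import Data.List.Membership.Propositional using (_∈_)
open import Data.Fin using (Fin; toℕ)
import Data.Fin.Subset as S
open import Data.Empty using (⊥)
open import Relation.Nullary using (¬_)
open import Relation.Binary.PropositionalEquality using (_≡_; _≢_)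
open import Function.Bundles using (_⇔_)

data Tile : Set where
  empty horiz vert pivot cross elbow : Tile

-- An array of tiles; only boxes (i , j) with i < n, j < n are meaningful.
Grid : Set
Grid = ℕ → ℕ → Tile

hasTop hasBottom hasLeft hasRight : Tile → Bool
hasTop vert  = true
hasTop pivot = true
hasTop cross = true
hasTop elbow = true
hasTop _     = false
hasBottom vert  = true
hasBottom cross = true
hasBottom elbow = true
hasBottom _     = false
hasLeft horiz = true
hasLeft cross = true
hasLeft elbow = true
hasLeft _     = false
hasRight horiz = true
hasRight pivot = true
hasRight cross = true
hasRight elbow = true
hasRight _     = false

data Dir : Set where
  fromTop fromLeft : Dir

-- A pipe entering a tile from side d leaves it either through the bottom
-- (entering the next box fromTop) or through the right (entering the next
-- box fromLeft); nothing if the tile has no strand starting at that side.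
next : Tile → Dir → Maybe Dir
next vert  fromTop  = just fromTop
next cross fromTop  = just fromTop
next pivot fromTop  = just fromLeft
next elbow fromTop  = just fromLeft
next horiz fromLeft = just fromLeft
next cross fromLeft = just fromLeft
next elbow fromLeft = just fromTop
next _     _        = nothing

module _ (n : ℕ) (D : Grid) where

  -- Reach a i j d : the pipe labelled a (entering the top edge of column a)
  -- arrives at position (i , j) through side d.  Reach a i n fromLeft means
  -- the pipe leaves the right edge of the array in row i.
  data Reach (a : ℕ) : ℕ → ℕ → Dir → Set where
    start : Reach a 0 a fromTop
    down  : ∀ {i j d} → i < n → j < n → Reach a i j d →
            next (D i j) d ≡ just fromTop → Reach a (suc i) j fromTop
    right : ∀ {i j d} → i < n → j < n → Reach a i j d →
            next (D i j) d ≡ just fromLeft → Reach a i (suc j) fromLeft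

  Crossing : ℕ → ℕ → ℕ → ℕ → Set
  Crossing a b i j = i < n × j < n × D i j ≡ cross × Reach a i j fromTop × Reach b i j fromLeft

  Crosses : ℕ → ℕ → ℕ → ℕ → Set
  Crosses a b i j = Crossing a b i j ⊎ Crossing b a i j

  Touching : ℕ → ℕ → ℕ → ℕ → Set
  Touching a b i j = i < n × j < n × D i j ≡ elbow × Reach a i j fromTop × Reach b i j fromLeft

  Touches : ℕ → ℕ → ℕ → ℕ → Set
  Touches a b i j = Touching a b i j ⊎ Touching b a i j

  Reduced : Set
  Reduced = ∀ a b i j i' j' → Crosses a b i j → Crosses a b i' j' → i ≡ i' × j ≡ j'

  NoTouchSEOfCrossing : Set
  NoTouchSEOfCrossing = ∀ a b i j i' j' → Crosses a b i j → Touches a b i' j' → ¬ (i ≤ i' × j ≤ j')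

  -- The tiling consists of n pipes, each from the top edge to the right edge:
  -- every top-edge midpoint and every right-edge midpoint is used, no strand
  -- meets the left or bottom edge, and strands of adjacent boxes match.
  PipesTopToRight : Set
  PipesTopToRight =
      (∀ j → j < n → hasTop (D 0 j) ≡ true)
    × (∀ i → i < n → hasRight (D i (pred n)) ≡ true)
    × (∀ i → i < n → hasLeft (D i 0) ≡ false)
    × (∀ j → j < n → hasBottom (D (pred n) j) ≡ false)
    × (∀ i j → i < n → suc j < n → hasRight (D i j) ≡ hasLeft (D i (suc j)))
    × (∀ i j → suc i < n → j < n → hasBottom (D i j) ≡ hasTop (D (suc i) j))

IsPermutation : ℕ → (ℕ → ℕ) → Set
IsPermutation n u = (∀ i → i < n → u i < n) × (∀ i i' → i < n → i' < n → u i ≡ u i' → i ≡ i')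

InvBefore : (ℕ → ℕ) → ℕ → ℕ → Set
InvBefore u i j = ∃ λ i' → i' < i × u i' ≡ j

InvAfter : ℕ → (ℕ → ℕ) → ℕ → ℕ → Set
InvAfter n u i j = ∃ λ i' → i < i' × i' < n × u i' ≡ j

IsRothe : ℕ → Grid → (ℕ → ℕ) → Set
IsRothe n D u =
    IsPermutation n u
  × PipesTopToRight n D
  × (∀ i → i < n → D i (u i) ≡ pivot)
  × (∀ i j → i < n → j < n → InvBefore u i j → j < u i → D i j ≡ empty)
  × (∀ i j → i < n → j < n → InvBefore u i j → u i < j → D i j ≡ horiz)
  × (∀ i j → i < n → j < n → InvAfter n u i j → j < u i → D i j ≡ vert)
  × (∀ i j → i < n → j < n → InvAfter n u i j → u i < j → (D i j ≡ cross ⊎ D i j ≡ elbow))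

HasExitPermutation : ℕ → Grid → (ℕ → ℕ) → Set
HasExitPermutation n D v = ∀ i → i < n → v i < n × Reach n D (v i) i n fromLeft

IsFPP : ℕ → Grid → (ℕ → ℕ) → (ℕ → ℕ) → Set
IsFPP n D u v =
    IsRothe n D u
  × Reduced n D
  × HasExitPermutation n D v
  × NoTouchSEOfCrossing n D

restrict : ℕ → ℕ → Grid → Grid
restrict n k E i j = if (i <ᵇ k) ∧ (j <ᵇ n) then E i j else empty

IsPartialFPP : ℕ → ℕ → (ℕ → ℕ) → Grid → Set
IsPartialFPP n k u D =
  k ≤ n × Σ (ℕ → ℕ) λ v → Σ Grid λ E → IsFPP n E u v × (∀ i j → D i j ≡ restrict n k E i j)

data Node : Set where
  box  : ℕ → ℕ → Node
  sink : ℕ → Node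

module _ (n : ℕ) (D : Grid) where

  IsVtx : ℕ → ℕ → Set
  IsVtx i j = i < n × j < n × (D i j ≡ pivot ⊎ D i j ≡ elbow)

  data Edge : Node → Node → Set where
    up     : ∀ {i i' j} → IsVtx i j → IsVtx i' j → i' < i →
             (∀ m → i' < m → m < i → ¬ IsVtx m j) → Edge (box i j) (box i' j)
    upSink : ∀ {i j} → IsVtx i j → (∀ m → m < i → ¬ IsVtx m j) → Edge (box i j) (sink j)
    right  : ∀ {i j' j} → IsVtx i j' → IsVtx i j → D i j ≡ elbow → j' < j →
             (∀ m → j' < m → m < j → ¬ IsVtx i m) → Edge (box i j') (box i j)

  data WalkTo (t : ℕ) : List Node → Set where
    end  : WalkTo t (sink t ∷ [])
    step : ∀ {x y ps} → Edge x y → WalkTo t (y ∷ ps) → WalkTo t (x ∷ y ∷ ps)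

  SourceSinkPath : List Node → ℕ → Set
  SourceSinkPath p t =
    Σ ℕ λ i → Σ ℕ λ j → Σ (List Node) λ rest →
      p ≡ box i j ∷ rest × IsVtx i j × D i j ≡ pivot × WalkTo t p

  record AdmissibleCollection (k : ℕ) : Set where
    field
      paths    : Fin k → List Node
      ends     : Fin k → ℕ
      isPath   : ∀ r → SourceSinkPath (paths r) (ends r)
      disjoint : ∀ r r' → r ≢ r' → ∀ x → x ∈ paths r → x ∈ paths r' → ⊥

  InB : ℕ → S.Subset n → Set
  InB k J =
    S.∣ J ∣ ≡ k ×
    Σ (AdmissibleCollection k) λ C →
      ∀ (j : Fin n) → (j S.∈ J) ⇔ (∃ λ r → AdmissibleCollection.ends C r ≡ toℕ j)

-- Standardization st_i (0-based row i, requires u i < u (i+1))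

isCrossB : Tile → Bool
isCrossB cross = true
isCrossB _     = false

isElbowOrPivotB : Tile → Bool
isElbowOrPivotB elbow = true
isElbowOrPivotB pivot = true
isElbowOrPivotB _     = false

searchJ : Grid → ℕ → ℕ → ℕ → Maybe ℕ
searchJ D i j zero    = nothing
searchJ D i j (suc r) =
  if isCrossB (D i j) ∧ isElbowOrPivotB (D (suc i) j) then just j else searchJ D i (suc j) r

-- j* (nothing encodes j* = ∞)
jStar : ℕ → (ℕ → ℕ) → ℕ → Grid → Maybe ℕ
jStar n u i D = searchJ D i (u (suc i)) (n ∸ u (suc i))

st : ℕ → (ℕ → ℕ) → ℕ → Grid → Grid
st n u i D r c =
  if (r ≡ᵇ i) ∧ (c ≡ᵇ u i) then vert
  else if (r ≡ᵇ suc i) ∧ (c ≡ᵇ u (suc i)) then horiz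
  else if (r ≡ᵇ suc i) ∧ maybe′ (λ s → (u (suc i) <ᵇ s) ∧ (c ≡ᵇ s)) false js then elbow
  else if (r ≡ᵇ i) ∧ swapCol then D (suc i) c
  else if (r ≡ᵇ suc i) ∧ swapCol then D i c
  else D r c
  where
  js : Maybe ℕ
  js = jStar n u i D
  swapCol : Bool
  swapCol = (c ≤ᵇ u (suc i)) ∨ maybe′ (λ s → s ≤ᵇ c) false js

-- Record a family of vertex-disjoint paths by the box edges it runs through.  Then
-- J lies in B(D) iff some such flow leaves the array above exactly at J, and only
-- rows i and i+1 distinguish D from st_i(D).  Reading these two rows column by
-- column, with given inputs below and outputs above, the pairs of horizontal carries
-- of D and st_i(D) can be matched, except where a path of D coming from below would
-- cross, at a cross tile of row i+1, a path running in that row.  This never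
-- happens: if a pipe q is crossed from above, then q descends at the next elbow,
-- every pipe crossed by q stays southwest of it, and if one of them has a vertex
-- further down, following q downwards shows that the elbow is entered from below in
-- every flow.

module Submission where

open import Defs
open import Data.Bool using (Bool; true; false; T; if_then_else_; _∧_; _∨_)
open import Data.Bool.Properties using (T-≡; ∨-zeroʳ)
open import Data.Empty using (⊥; ⊥-elim)
open import Data.Fin as Fin using (Fin; toℕ; fromℕ<)
import Data.Fin.Properties as Finₚ
open import Data.Fin.Subset using (Subset)
import Data.Fin.Subset as S
open import Data.Fin.Subset.Properties using (∣⊤∣≡n; ∈⊤; x∈p∧x≢y⇒x∈p-y; x∈p⇒∣p-x∣<∣p∣)
open import Data.List using (List; []; _∷_)
open import Data.List.Membership.Propositional using (_∈_)
import Data.List.Membership.Propositional as Mem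
open import Data.List.Relation.Unary.All as All using (All; []; _∷_)
open import Data.List.Relation.Unary.Any as Any using (here; there)
open import Data.Maybe using (Maybe; just; nothing; maybe′)
open import Data.Nat using (ℕ; zero; suc; _+_; _∸_; _<_; _≤_; z≤n; s≤s; s≤s⁻¹;
                            _≟_; _<?_; _≤?_; _≡ᵇ_; _≤ᵇ_; _<ᵇ_)
open import Data.Nat.Properties hiding (_≟_; _<?_; _≤?_)
open import Data.Product using (∃; ∃₂; _×_; _,_; proj₁; proj₂)
open import Data.Sum using (_⊎_; inj₁; inj₂)
open import Data.Unit using (⊤; tt)
open import Data.Vec using (lookup)
open import Data.Vec.Properties using ([]=⇒lookup; lookup⇒[]=)
open import Function using (_∘_)
open import Function.Bundles using (_⇔_; mk⇔; Equivalence)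
open import Relation.Binary using (tri<; tri≈; tri>)
open import Relation.Binary.PropositionalEquality using (_≡_; _≢_; refl; sym; trans; cong; subst; subst₂)
open import Relation.Nullary using (¬_; Dec; yes; no; does; contradiction)
open import Relation.Nullary.Decidable using (does-⇔; map′; _×-dec_; dec-true; dec-false)

-- The carries of the two arrays do not simply agree, because the source of row i+1 of D lies in row
-- i of st_i(D): a path leaving it to the right may run one row lower in D than its counterpart.
-- This lag is repaired where two elbows lie above each other, or at j*. An elbow above a cross is
-- the one place where it could do harm, since an input from below would compete with the
-- counterpart for that elbow. A cross above an elbow cannot occur before j*, and beyond j* row i of
-- D has no vertex, so there the rows trade places as a whole.
--
-- The exclusion must hold for the flows of both arrays. It concerns the flow from row i+2 on, where
-- both agree with the full pipe dream; in either case the pipes followed are those of the latter.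
--
-- Following one pipe is not enough: a path that turns right at one of its vertices is refuted at
-- the next elbow, whose column must then be treated too while the old one remains. So the induction
-- runs over sets of marked columns. No mark survives to the row of the low vertex, hence none
-- reaches the bottom edge, where the claim would fail.

injection⇒≤∣p∣ : ∀ {m k} (f : Fin k → Fin m) (p : Subset m) → (∀ {r r'} → f r ≡ f r' → r ≡ r') →
                 (∀ r → f r S.∈ p) → k ≤ S.∣ p ∣
injection⇒≤∣p∣ {k = zero}  f p inj mem = z≤n
injection⇒≤∣p∣ {k = suc k} f p inj mem =
  ≤-<-trans (injection⇒≤∣p∣ (f ∘ Fin.suc) (p S.- f Fin.zero) (Finₚ.suc-injective ∘ inj)
               λ r → x∈p∧x≢y⇒x∈p-y (mem (Fin.suc r)) λ e → contradiction (inj e) λ ())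
            (x∈p⇒∣p-x∣<∣p∣ (mem Fin.zero))

-- A missed element could be deleted from `p`, leaving too few elements for an injection. Three
-- times this count replaces the construction of an inverse: every source is used, every element of
-- `J` is an end, and `u` is onto.
injection-onto : ∀ {m k} (f : Fin k → Fin m) (p : Subset m) → (∀ {r r'} → f r ≡ f r' → r ≡ r') →
                 (∀ r → f r S.∈ p) → S.∣ p ∣ ≡ k → ∀ {y} → y S.∈ p → ∃ λ r → f r ≡ y
injection-onto f p inj mem size {y} y∈p with Finₚ.any? (λ r → f r Finₚ.≟ y)
... | yes hit = hit
... | no miss = contradiction size (>⇒≢ (≤-<-trans
      (injection⇒≤∣p∣ f (p S.- y) inj λ r → x∈p∧x≢y⇒x∈p-y (mem r) λ e → miss (r , e))
      (x∈p⇒∣p-x∣<∣p∣ y∈p)))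

-- Flows, and what an array must satisfy to have them

data Kind : Set where
  pass elb piv : Kind

-- G(D) sees only whether a box holds a vertex and whether that vertex is a source, so crosses,
-- straight pipes and empty boxes fall together.
kind : Tile → Kind
kind pivot = piv
kind elbow = elb
kind _     = pass

kind-piv : ∀ t → kind t ≡ piv → t ≡ pivot
kind-piv pivot _ = refl

kind-elb : ∀ t → kind t ≡ elb → t ≡ elbow
kind-elb elbow _ = refl

pass⇒¬vtx : ∀ {n W i j} → kind (W i j) ≡ pass → ¬ IsVtx n W i j
pass⇒¬vtx e (_ , _ , inj₁ p) = contradiction (trans (sym e) (cong kind p)) λ ()
pass⇒¬vtx e (_ , _ , inj₂ p) = contradiction (trans (sym e) (cong kind p)) λ ()

-- Rule κ h v h' v': the ways in which vertex-disjoint paths using every source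
-- can traverse a box of kind κ, where h, v, h', v' tell whether a path runs
-- through the left, bottom, right and top edge of the box.
data Rule : Kind → Bool → Bool → Bool → Bool → Set where
  thru   : ∀ {h v} → Rule pass h v h v
  idle   : Rule elb false false false false
  →→     : Rule elb true  false true  false
  →↑     : Rule elb true  false false true
  ↑→     : Rule elb false true  true  false
  ↑↑     : Rule elb false true  false true
  source→ : Rule piv false false true  false
  source↑ : Rule piv false false false true

-- h r j and v r j tell whether a path runs through the left, respectively the
-- top, edge of box (r , j); hence v (suc r) j belongs to its bottom edge.
record Flow (n k : ℕ) (W : Grid) (J : Subset n) : Set where
  field
    h v       : ℕ → ℕ → Bool
    leftEnd   : ∀ {r} → r < k → h r 0 ≡ false
    rightEnd  : ∀ {r} → r < k → h r n ≡ false
    bottomEnd : ∀ {j} → j < n → v k j ≡ false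
    topEnd    : ∀ j → v 0 (toℕ j) ≡ lookup J j
    rule      : ∀ {r j} → r < k → j < n →
                Rule (kind (W r j)) (h r j) (v (suc r) j) (h r (suc j)) (v r j)

-- The properties shared by D and st_i D that make InB a condition on flows.
record Network (n k : ℕ) (W : Grid) (w : ℕ → ℕ) : Set where
  field
    k≤n       : k ≤ n
    inside    : ∀ {i j} → IsVtx n W i j → i < k
    column<   : ∀ {i} → i < k → w i < n
    pivotAt   : ∀ {i} → i < k → W i (w i) ≡ pivot
    pivot⇒w   : ∀ {i j} → i < k → j < n → W i j ≡ pivot → j ≡ w i
    noneLeft  : ∀ {i j} → IsVtx n W i j → w i ≤ j
    noneBelow : ∀ {i i'} → i < k → i < i' → ¬ IsVtx n W i' (w i)

  vtx : ∀ {i} → i < k → IsVtx n W i (w i)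
  vtx i<k = <-≤-trans i<k k≤n , column< i<k , inj₁ (pivotAt i<k)


-- Walks in G(D)

steps : List Node → List (Node × Node)
steps (x ∷ y ∷ p) = (x , y) ∷ steps (y ∷ p)
steps _           = []

steps-∈ˡ : ∀ {x y} p → (x , y) ∈ steps p → x ∈ p
steps-∈ˡ (_ ∷ _ ∷ _) (here refl) = here refl
steps-∈ˡ (_ ∷ y ∷ p) (there m)   = there (steps-∈ˡ (y ∷ p) m)

steps-∈ʳ : ∀ {x y z} p → (x , y) ∈ steps (z ∷ p) → y ∈ p
steps-∈ʳ (_ ∷ _) (here refl) = here refl
steps-∈ʳ (y ∷ p) (there m)   = there (steps-∈ʳ p m)

module _ {n : ℕ} {W : Grid} where

  vtx? : ∀ i j → Dec (IsVtx n W i j)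
  vtx? i j = (i <? n) ×-dec ((j <? n) ×-dec tile? (W i j))
    where
    tile? : ∀ t → Dec (t ≡ pivot ⊎ t ≡ elbow)
    tile? pivot = yes (inj₁ refl)
    tile? elbow = yes (inj₂ refl)
    tile? empty = no λ { (inj₁ ()) ; (inj₂ ()) }
    tile? horiz = no λ { (inj₁ ()) ; (inj₂ ()) }
    tile? vert  = no λ { (inj₁ ()) ; (inj₂ ()) }
    tile? cross = no λ { (inj₁ ()) ; (inj₂ ()) }

  -- A potential that grows along every edge, so that no walk returns to a vertex. The `suc` lifts a
  -- sink above the box in row 0 of its column, which already has rank `j + n`.
  rank : Node → ℕ
  rank (box i j) = j + (n ∸ i)
  rank (sink j)  = suc (j + n)

  edge-rank : ∀ {x y} → Edge n W x y → rank x < rank y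
  edge-rank (up {i} {i'} {j} (i<n , _) _ i'<i _) = +-monoʳ-< j (∸-monoʳ-< i'<i (<⇒≤ i<n))
  edge-rank (upSink {i} {j} _ _)      = s≤s (+-monoʳ-≤ j (m∸n≤m n i))
  edge-rank (right {i} _ _ _ j'<j _)  = +-monoˡ-< (n ∸ i) j'<j

  walk-rank : ∀ {t x p} → WalkTo n W t (x ∷ p) → All (λ y → rank x < rank y) p
  walk-rank end        = []
  walk-rank (step e w) = edge-rank e ∷ All.map (<-trans (edge-rank e)) (walk-rank w)

  walk-edge : ∀ {t p x y} → WalkTo n W t p → (x , y) ∈ steps p → Edge n W x y
  walk-edge (step e w) (here refl) = e
  walk-edge (step e w) (there m)   = walk-edge w m

  walk-succ-unique : ∀ {t p x y y'} → WalkTo n W t p → (x , y) ∈ steps p → (x , y') ∈ steps p → y ≡ y'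
  walk-succ-unique (step e w) (here refl) (here refl) = refl
  walk-succ-unique (step {ps = ps} e w) (here refl) (there m) =
    ⊥-elim (<-irrefl refl (All.lookup (walk-rank (step e w)) (steps-∈ˡ _ m)))
  walk-succ-unique (step e w) (there m) (here refl) =
    ⊥-elim (<-irrefl refl (All.lookup (walk-rank (step e w)) (steps-∈ˡ _ m)))
  walk-succ-unique (step e w) (there m) (there m') = walk-succ-unique w m m'

  walk-pred-unique : ∀ {t p x x' y} → WalkTo n W t p → (x , y) ∈ steps p → (x' , y) ∈ steps p → x ≡ x'
  walk-pred-unique (step e w) (here refl) (here refl) = refl
  walk-pred-unique (step e w) (here refl) (there m) =
    ⊥-elim (<-irrefl refl (All.lookup (walk-rank w) (steps-∈ʳ _ m)))
  walk-pred-unique (step e w) (there m) (here refl) =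
    ⊥-elim (<-irrefl refl (All.lookup (walk-rank w) (steps-∈ʳ _ m)))
  walk-pred-unique (step e w) (there m) (there m') = walk-pred-unique w m m'

  walk-succ : ∀ {t p i j} → WalkTo n W t p → box i j ∈ p → ∃ λ y → (box i j , y) ∈ steps p
  walk-succ end (here ())
  walk-succ end (there ())
  walk-succ (step e w) (here refl) = _ , here refl
  walk-succ (step e w) (there m)   = let y , s = walk-succ w m in y , there s

  walk-pred : ∀ {t z p y} → WalkTo n W t (z ∷ p) → y ∈ p → ∃ λ x → (x , y) ∈ steps (z ∷ p)
  walk-pred end ()
  walk-pred (step e w) (here refl) = _ , here refl
  walk-pred (step e w) (there m)   = let x , s = walk-pred w m in x , there s

  walk-sink : ∀ {t p j} → WalkTo n W t p → sink j ∈ p → j ≡ t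
  walk-sink end (here refl) = refl
  walk-sink end (there ())
  walk-sink (step () w) (here refl)
  walk-sink (step e w) (there m) = walk-sink w m

  walk-end : ∀ {t p} → WalkTo n W t p → sink t ∈ p
  walk-end end        = here refl
  walk-end (step e w) = there (walk-end w)

-- The edge of G(D) runs through the left (CovH) or top (CovV) edge of box (i , j).
CovH CovV : ℕ → ℕ → Node × Node → Set
CovH i j (box i₁ j₁ , box i₂ j₂) = i₁ ≡ i × i₂ ≡ i × j₁ < j × j ≤ j₂
CovH i j _                       = ⊥
CovV i j (box i₁ j₁ , box i₂ j₂) = j₁ ≡ j × j₂ ≡ j × i ≤ i₁ × i₂ < i
CovV i j (box i₁ j₁ , sink j₂)   = j₁ ≡ j × j₂ ≡ j × i ≤ i₁
CovV i j _                       = ⊥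

covH? : ∀ i j e → Dec (CovH i j e)
covH? i j (box i₁ j₁ , box i₂ j₂) = (i₁ ≟ i) ×-dec ((i₂ ≟ i) ×-dec ((j₁ <? j) ×-dec (j ≤? j₂)))
covH? i j (box _ _ , sink _) = no λ ()
covH? i j (sink _ , _)       = no λ ()

covV? : ∀ i j e → Dec (CovV i j e)
covV? i j (box i₁ j₁ , box i₂ j₂) = (j₁ ≟ j) ×-dec ((j₂ ≟ j) ×-dec ((i ≤? i₁) ×-dec (i₂ <? i)))
covV? i j (box i₁ j₁ , sink j₂)   = (j₁ ≟ j) ×-dec ((j₂ ≟ j) ×-dec (i ≤? i₁))
covV? i j (sink _ , _)            = no λ ()

edge-source : ∀ {n W i j y} → Edge n W (box i j) y → IsVtx n W i j
edge-source (up s _ _ _)      = s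
edge-source (upSink s _)      = s
edge-source (right s _ _ _ _) = s

edge-target : ∀ {n W i j x} → Edge n W x (box i j) → IsVtx n W i j
edge-target (up _ t _ _)      = t
edge-target (right _ t _ _ _) = t

column : Node → ℕ
column (box i j) = j
column (sink j)  = j

-- From collections of paths to flows

module CollectionFlow {n k : ℕ} {W : Grid} {w : ℕ → ℕ} (net : Network n k W w)
                      (C : AdmissibleCollection n W k) where
  open Network net
  open AdmissibleCollection C

  Used : Node × Node → Set
  Used e = ∃ λ r → e ∈ steps (paths r)

  walk : ∀ r → WalkTo n W (ends r) (paths r)
  walk r = let _ , _ , _ , _ , _ , _ , wk = isPath r in wk

  same : ∀ {r r' x} → x ∈ paths r → x ∈ paths r' → r ≡ r'
  same {r} {r'} m m' with r Finₚ.≟ r'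
  ... | yes e = e
  ... | no ne = ⊥-elim (disjoint r r' ne _ m m')

  source∈ : ∀ {x y} → Used (x , y) → ∃ λ r → x ∈ paths r
  source∈ (r , m) = r , steps-∈ˡ _ m

  target∈ : ∀ {x y} → Used (x , y) → ∃ λ r → y ∈ paths r
  target∈ (r , m) = r , go (paths r) m
    where
    go : ∀ {x y} p → (x , y) ∈ steps p → y ∈ p
    go (_ ∷ p) m = there (steps-∈ʳ p m)

  edge : ∀ {x y} → Used (x , y) → Edge n W x y
  edge (r , m) = walk-edge (walk r) m

  succ-unique : ∀ {x y y'} → Used (x , y) → Used (x , y') → y ≡ y'
  succ-unique (r , m) (r' , m') with same (steps-∈ˡ _ m) (steps-∈ˡ _ m')
  ... | refl = walk-succ-unique (walk r) m m'

  pred-unique : ∀ {x x' y} → Used (x , y) → Used (x' , y) → x ≡ x'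
  pred-unique u@(r , m) u'@(r' , m') with same (proj₂ (target∈ u)) (proj₂ (target∈ u'))
  ... | refl = walk-pred-unique (walk r) m m'

  succ-exists : ∀ {i j r} → box i j ∈ paths r → ∃ λ y → Used (box i j , y)
  succ-exists {r = r} m = let y , s = walk-succ (walk r) m in y , r , s

  pred-exists : ∀ {i j r} → W i j ≡ elbow → box i j ∈ paths r → ∃ λ x → Used (x , box i j)
  pred-exists {r = r} e m with paths r in eq | isPath r
  ... | .(box i₀ j₀ ∷ rest) | i₀ , j₀ , rest , refl , _ , pv , wk with m
  ...   | here refl = contradiction (trans (sym pv) e) λ ()
  ...   | there m'  = let x , s = walk-pred wk m' in x , r , subst (λ p → _ ∈ steps p) (sym eq) s

  startRow : Fin k → Fin k
  startRow r = let _ , _ , _ , _ , vx , _ = isPath r in fromℕ< (inside vx)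

  start∈ : ∀ r → box (toℕ (startRow r)) (w (toℕ (startRow r))) ∈ paths r
  start∈ r with isPath r
  ... | i , j , rest , eq , vx , pv , _ rewrite Finₚ.toℕ-fromℕ< (inside vx) | eq
        | pivot⇒w (inside vx) (proj₁ (proj₂ vx)) pv = here refl

  startRow-injective : ∀ {r r'} → startRow r ≡ startRow r' → r ≡ r'
  startRow-injective {r} {r'} e =
    same (subst (λ s → box (toℕ s) (w (toℕ s)) ∈ paths r) e (start∈ r)) (start∈ r')

  -- The `k` paths are disjoint, so their sources lie in `k` different rows, hence in all of them.
  -- This is why `Rule` has no idle pivot.
  source-used : ∀ {i} → i < k → ∃ λ y → Used (box i (w i) , y)
  source-used {i} i<k with injection-onto startRow S.⊤ startRow-injective (λ _ → ∈⊤) (∣⊤∣≡n k)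
                                          {fromℕ< i<k} ∈⊤
  ... | r , e = succ-exists {r = r} (subst (λ i → box i (w i) ∈ paths r)
                  (trans (cong toℕ e) (Finₚ.toℕ-fromℕ< i<k)) (start∈ r))

  H V : ℕ → ℕ → Set
  H i j = ∃ λ e → CovH i j e × Used e
  V i j = ∃ λ e → CovV i j e × Used e

  covered? : ∀ {P : Node × Node → Set} → (∀ e → Dec (P e)) → Dec (∃ λ e → P e × Used e)
  covered? P? = map′ (λ (r , a) → let e , m , p = Mem.find a in e , p , r , m)
                     (λ (e , p , r , m) → r , Mem.lose m p)
                     (Finₚ.any? λ r → Any.any? P? (steps (paths r)))

  H? : ∀ i j → Dec (H i j)
  H? i j = covered? (covH? i j)

  V? : ∀ i j → Dec (V i j)
  V? i j = covered? (covV? i j)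

  leaves : ∀ {i j y} → Used (box i j , y) → H i (suc j) ⊎ V i j
  leaves u with edge u
  ... | up _ _ i'<i _    = inj₂ (_ , (refl , refl , ≤-refl , i'<i) , u)
  ... | upSink _ _       = inj₂ (_ , (refl , refl , ≤-refl) , u)
  ... | right _ _ _ j<j' _ = inj₁ (_ , (refl , refl , ≤-refl , j<j') , u)

  enters : ∀ {i j x} → Used (x , box i j) → H i j ⊎ V (suc i) j
  enters u with edge u
  ... | up _ _ i'<i _    = inj₂ (_ , (refl , refl , i'<i , ≤-refl) , u)
  ... | right _ _ _ j<j' _ = inj₁ (_ , (refl , refl , j<j' , ≤-refl) , u)

  module _ {i j : ℕ} (vx : IsVtx n W i j) where

    -- An edge of G(D) skips no vertex, so an edge running through a side of a vertex box begins or
    -- ends at that vertex. The same reason serves `H-out`, `V-in` and `V-out`.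
    H-in : H i j → ∃ λ j₁ → j₁ < j × Used (box i j₁ , box i j)
    H-in ((box _ j₁ , box _ j₂) , (refl , refl , l , l') , u) with edge u | m≤n⇒m<n∨m≡n l'
    ... | _                 | inj₂ refl = j₁ , l , u
    ... | up _ _ i<i _      | inj₁ _    = ⊥-elim (<-irrefl refl i<i)
    ... | right _ _ _ _ gap | inj₁ j<j₂ = ⊥-elim (gap j l j<j₂ vx)

    H-out : H i (suc j) → ∃ λ j₂ → j < j₂ × Used (box i j , box i j₂)
    H-out ((box _ j₁ , box _ j₂) , (refl , refl , s≤s l , l') , u) with edge u | m≤n⇒m<n∨m≡n l
    ... | _                 | inj₂ refl = j₂ , l' , u
    ... | up _ _ i<i _      | inj₁ _    = ⊥-elim (<-irrefl refl i<i)
    ... | right _ _ _ _ gap | inj₁ j₁<j = ⊥-elim (gap j j₁<j l' vx)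

    V-in : V (suc i) j → ∃ λ x → column x ≡ j × Used (x , box i j)
    V-in ((box i₁ _ , box i₂ _) , (refl , refl , l , s≤s l') , u) with edge u | m≤n⇒m<n∨m≡n l'
    ... | _               | inj₂ refl = _ , refl , u
    ... | up _ _ _ gap    | inj₁ i₂<i = ⊥-elim (gap i i₂<i l vx)
    ... | right _ _ _ j<j _ | inj₁ _  = ⊥-elim (<-irrefl refl j<j)
    V-in ((box i₁ _ , sink _) , (refl , refl , l) , u) with edge u
    ... | upSink _ gap = ⊥-elim (gap i l vx)

    V-out : V i j → ∃ λ y → column y ≡ j × Used (box i j , y)
    V-out ((box i₁ _ , box i₂ _) , (refl , refl , l , l') , u) with edge u | m≤n⇒m<n∨m≡n l
    ... | _               | inj₂ refl = _ , refl , u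
    ... | up _ _ _ gap    | inj₁ i<i₁ = ⊥-elim (gap i l' i<i₁ vx)
    ... | right _ _ _ j<j _ | inj₁ _  = ⊥-elim (<-irrefl refl j<j)
    V-out ((box i₁ _ , sink _) , (refl , refl , l) , u) with edge u | m≤n⇒m<n∨m≡n l
    ... | _            | inj₂ refl = _ , refl , u
    ... | upSink _ gap | inj₁ i<i₁ = ⊥-elim (gap i i<i₁ vx)

    not-both-in : H i j → ¬ V (suc i) j
    not-both-in a b with H-in a | V-in b
    ... | j₁ , l , u | x , refl , u' with pred-unique u u'
    ... | refl = <-irrefl refl l

    not-both-out : H i (suc j) → ¬ V i j
    not-both-out a b with H-out a | V-out b
    ... | j₂ , l , u | y , refl , u' with succ-unique u u'
    ... | refl = <-irrefl refl l

    in⇒out : H i j ⊎ V (suc i) j → H i (suc j) ⊎ V i j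
    in⇒out (inj₁ a) = let _ , _ , u = H-in a in leaves (proj₂ (succ-exists (proj₂ (target∈ u))))
    in⇒out (inj₂ b) = let _ , _ , u = V-in b in leaves (proj₂ (succ-exists (proj₂ (target∈ u))))

    out⇒in : W i j ≡ elbow → H i (suc j) ⊎ V i j → H i j ⊎ V (suc i) j
    out⇒in e (inj₁ a) = let _ , _ , u = H-out a in enters (proj₂ (pred-exists e (proj₂ (source∈ u))))
    out⇒in e (inj₂ b) = let _ , _ , u = V-out b in enters (proj₂ (pred-exists e (proj₂ (source∈ u))))

  -- The constructor `up` of `Edge` admits a pivot as target. What rules this out is `noneBelow`: a
  -- pivot has no vertex below it in its column.
  not-in-pivot : ∀ {i j x} → W i j ≡ pivot → ¬ Used (x , box i j)
  not-in-pivot pv u with edge u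
  ... | up lower (i<n , j<n , _) i<i' _ with pivot⇒w (inside (i<n , j<n , inj₁ pv)) j<n pv
  ...   | refl = noneBelow (inside (i<n , j<n , inj₁ pv)) i<i' lower
  not-in-pivot pv u | right _ _ e _ _ = contradiction (trans (sym pv) e) λ ()

  H-pass : ∀ {i j} → ¬ IsVtx n W i j → H i j ⇔ H i (suc j)
  H-pass {i} {j} nv = mk⇔ to from
    where
    to : H i j → H i (suc j)
    to ((box _ j₁ , box _ j₂) , (refl , refl , l , l') , u) with m≤n⇒m<n∨m≡n l'
    ... | inj₁ l'' = _ , (refl , refl , m<n⇒m<1+n l , l'') , u
    ... | inj₂ refl = ⊥-elim (nv (edge-target (edge u)))
    from : H i (suc j) → H i j
    from ((box _ j₁ , box _ j₂) , (refl , refl , s≤s l , l') , u) with m≤n⇒m<n∨m≡n l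
    ... | inj₁ l'' = _ , (refl , refl , l'' , <⇒≤ l') , u
    ... | inj₂ refl = ⊥-elim (nv (edge-source (edge u)))

  V-pass : ∀ {i j} → ¬ IsVtx n W i j → V (suc i) j ⇔ V i j
  V-pass {i} {j} nv = mk⇔ to from
    where
    to : V (suc i) j → V i j
    to ((box _ _ , box _ _) , (refl , refl , l , s≤s l') , u) with m≤n⇒m<n∨m≡n l'
    ... | inj₁ l'' = _ , (refl , refl , <⇒≤ l , l'') , u
    ... | inj₂ refl = ⊥-elim (nv (edge-target (edge u)))
    to ((box _ _ , sink _) , (refl , refl , l) , u) = _ , (refl , refl , <⇒≤ l) , u
    from : V i j → V (suc i) j
    from ((box _ _ , box _ _) , (refl , refl , l , l') , u) with m≤n⇒m<n∨m≡n l
    ... | inj₁ l'' = _ , (refl , refl , l'' , m<n⇒m<1+n l') , u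
    ... | inj₂ refl = ⊥-elim (nv (edge-source (edge u)))
    from ((box _ _ , sink _) , (refl , refl , l) , u) with m≤n⇒m<n∨m≡n l
    ... | inj₁ l'' = _ , (refl , refl , l'') , u
    ... | inj₂ refl = ⊥-elim (nv (edge-source (edge u)))

  -- Arbitrary decisions take the place of `H?` and `V?`, so that they can be split and `does`
  -- computes in each case.
  elbowRule : ∀ {A B A' B' : Set} (a : Dec A) (b : Dec B) (a' : Dec A') (b' : Dec B') →
              (A → ¬ B) → (A' → ¬ B') → (A ⊎ B → A' ⊎ B') → (A' ⊎ B' → A ⊎ B) →
              Rule elb (does a) (does b) (does a') (does b')
  elbowRule (yes a) (yes b) _ _ ni _ _ _ = ⊥-elim (ni a b)
  elbowRule (yes a) (no _) (yes a') (yes b') _ nx _ _ = ⊥-elim (nx a' b')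
  elbowRule (yes a) (no _) (yes a') (no _) _ _ _ _ = →→
  elbowRule (yes a) (no _) (no _) (yes b') _ _ _ _ = →↑
  elbowRule (yes a) (no _) (no a') (no b') _ _ io _ with io (inj₁ a)
  ... | inj₁ x = ⊥-elim (a' x)
  ... | inj₂ x = ⊥-elim (b' x)
  elbowRule (no _) (yes b) (yes a') (yes b') _ nx _ _ = ⊥-elim (nx a' b')
  elbowRule (no _) (yes b) (yes a') (no _) _ _ _ _ = ↑→
  elbowRule (no _) (yes b) (no _) (yes b') _ _ _ _ = ↑↑
  elbowRule (no _) (yes b) (no a') (no b') _ _ io _ with io (inj₂ b)
  ... | inj₁ x = ⊥-elim (a' x)
  ... | inj₂ x = ⊥-elim (b' x)
  elbowRule (no a) (no b) (no _) (no _) _ _ _ _ = idle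
  elbowRule (no a) (no b) (yes a') _ _ _ _ oi with oi (inj₁ a')
  ... | inj₁ x = ⊥-elim (a x)
  ... | inj₂ x = ⊥-elim (b x)
  elbowRule (no a) (no b) _ (yes b') _ _ _ oi with oi (inj₂ b')
  ... | inj₁ x = ⊥-elim (a x)
  ... | inj₂ x = ⊥-elim (b x)

  pivotRule : ∀ {A B A' B' : Set} (a : Dec A) (b : Dec B) (a' : Dec A') (b' : Dec B') →
              ¬ A → ¬ B → (A' → ¬ B') → A' ⊎ B' →
              Rule piv (does a) (does b) (does a') (does b')
  pivotRule (yes a) _ _ _ na _ _ _ = ⊥-elim (na a)
  pivotRule (no _) (yes b) _ _ _ nb _ _ = ⊥-elim (nb b)
  pivotRule (no _) (no _) (yes a') (yes b') _ _ nx _ = ⊥-elim (nx a' b')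
  pivotRule (no _) (no _) (yes a') (no _) _ _ _ _ = source→
  pivotRule (no _) (no _) (no _) (yes b') _ _ _ _ = source↑
  pivotRule (no _) (no _) (no a') (no b') _ _ _ (inj₁ x) = ⊥-elim (a' x)
  pivotRule (no _) (no _) (no a') (no b') _ _ _ (inj₂ x) = ⊥-elim (b' x)

  passRule : ∀ {i j} → ¬ IsVtx n W i j →
             Rule pass (does (H? i j)) (does (V? (suc i) j)) (does (H? i (suc j))) (does (V? i j))
  passRule {i} {j} nv rewrite does-⇔ (H-pass nv) (H? i j) (H? i (suc j))
                            | does-⇔ (V-pass nv) (V? (suc i) j) (V? i j) = thru

  boxRule : ∀ {i j} → i < k → j < n →
            Rule (kind (W i j)) (does (H? i j)) (does (V? (suc i) j)) (does (H? i (suc j))) (does (V? i j))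
  boxRule {i} {j} i<k j<n with kind (W i j) in eq
  ... | pass = passRule (pass⇒¬vtx {W = W} eq)
  ... | elb  = elbowRule (H? i j) (V? (suc i) j) (H? i (suc j)) (V? i j)
                 (not-both-in vx) (not-both-out vx) (in⇒out vx) (out⇒in vx tile)
    where
    tile = kind-elb (W i j) eq
    vx   = <-≤-trans i<k k≤n , j<n , inj₂ tile
  ... | piv  = pivotRule (H? i j) (V? (suc i) j) (H? i (suc j)) (V? i j)
                 (λ a → not-in-pivot tile (proj₂ (proj₂ (H-in vx a))))
                 (λ b → not-in-pivot tile (proj₂ (proj₂ (V-in vx b))))
                 (not-both-out vx)
                 (let y , u = source-used i<k in
                  leaves (subst (λ c → Used (box i c , y)) (sym (pivot⇒w i<k j<n tile)) u))
    where
    tile = kind-piv (W i j) eq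
    vx   = <-≤-trans i<k k≤n , j<n , inj₁ tile

  no-H-left : ∀ {i} → ¬ H i 0
  no-H-left ((box _ _ , box _ _) , (_ , _ , () , _) , _)

  no-H-right : ∀ {i} → ¬ H i n
  no-H-right ((box _ _ , box _ _) , (_ , _ , _ , l) , u) =
    <⇒≱ (proj₁ (proj₂ (edge-target (edge u)))) l

  no-V-bottom : ∀ {j} → ¬ V k j
  no-V-bottom ((box _ _ , box _ _) , (_ , _ , l , _) , u) = <⇒≱ (inside (edge-source (edge u))) l
  no-V-bottom ((box _ _ , sink _) , (_ , _ , l) , u)      = <⇒≱ (inside (edge-source (edge u))) l

  V-top⇒end : ∀ {j} → V 0 j → ∃ λ r → ends r ≡ j
  V-top⇒end ((box _ _ , sink _) , (refl , refl , _) , u) =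
    let r , m = target∈ u in r , sym (walk-sink (walk r) m)

  end⇒V-top : ∀ r → V 0 (ends r)
  end⇒V-top r with paths r in eq | isPath r
  ... | .(box i j ∷ rest) | i , j , rest , refl , _ , _ , wk with walk-end wk
  ...   | there m with walk-pred wk m
  ...     | x , s with walk-edge wk s
  ...       | upSink {i'} _ _ = (box i' _ , sink _) , (refl , refl , z≤n) , r ,
                            subst (λ p → (box i' (ends r) , sink (ends r)) ∈ steps p) (sym eq) s

  flow : ∀ {J : Subset n} → (∀ j → (j S.∈ J) ⇔ (∃ λ r → ends r ≡ toℕ j)) → Flow n k W J
  flow {J} iff = record
    { h = λ i j → does (H? i j)
    ; v = λ i j → does (V? i j)
    ; leftEnd   = λ _ → dec-false (H? _ 0) no-H-left
    ; rightEnd  = λ _ → dec-false (H? _ n) no-H-right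
    ; bottomEnd = λ _ → dec-false (V? k _) no-V-bottom
    ; topEnd    = top
    ; rule      = boxRule
    }
    where
    top : ∀ j → does (V? 0 (toℕ j)) ≡ lookup J j
    top j with lookup J j in eq
    ... | true with Equivalence.to (iff j) (lookup⇒[]= j J eq)
    ...   | r , e = dec-true (V? 0 (toℕ j)) (subst (V 0) e (end⇒V-top r))
    top j | false = dec-false (V? 0 (toℕ j)) λ b →
      contradiction (trans (sym eq) ([]=⇒lookup (Equivalence.from (iff j) (V-top⇒end b)))) λ ()

-- From flows to collections of paths

module FlowScan {n k : ℕ} {W : Grid} {J : Subset n} (F : Flow n k W J) where
  open Flow F

  pass-rule : ∀ {r j} → r < k → j < n → kind (W r j) ≡ pass → h r (suc j) ≡ h r j × v r j ≡ v (suc r) j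
  pass-rule {r} {j} r<k j<n e with kind (W r j) | h r (suc j) | v r j | rule r<k j<n
  pass-rule r<k j<n refl | .pass | _ | _ | thru = refl , refl

  ¬vtx⇒pass : ∀ {i j} → i < n → j < n → ¬ IsVtx n W i j → kind (W i j) ≡ pass
  ¬vtx⇒pass {i} {j} i<n j<n nv with kind (W i j) in eq
  ... | pass = refl
  ... | elb  = ⊥-elim (nv (i<n , j<n , inj₂ (kind-elb _ eq)))
  ... | piv  = ⊥-elim (nv (i<n , j<n , inj₁ (kind-piv _ eq)))

  not-both-in : ∀ {i j} → i < k → IsVtx n W i j → h i j ≡ true → v (suc i) j ≡ true → ⊥
  not-both-in {i} {j} i<k (_ , j<n , t) a b
    with kind (W i j) in eq | h i j | v (suc i) j | h i (suc j) | v i j | rule i<k j<n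
  not-both-in i<k vx refl refl | .pass | .true | .true | _ | _ | thru = pass⇒¬vtx {W = W} eq vx

  enter : ∀ {i j} → i < k → IsVtx n W i j → h i j ≡ true ⊎ v (suc i) j ≡ true →
          W i j ≡ elbow × (h i (suc j) ≡ true ⊎ v i j ≡ true)
  enter {i} {j} i<k vx@(_ , j<n , _) a
    with kind (W i j) in eq | h i j | v (suc i) j | h i (suc j) | v i j | rule i<k j<n
  ... | _ | _ | _ | _ | _ | thru = ⊥-elim (pass⇒¬vtx {W = W} eq vx)
  ... | _ | _ | _ | _ | _ | →→ = kind-elb _ eq , inj₁ refl
  ... | _ | _ | _ | _ | _ | →↑ = kind-elb _ eq , inj₂ refl
  ... | _ | _ | _ | _ | _ | ↑→ = kind-elb _ eq , inj₁ refl
  ... | _ | _ | _ | _ | _ | ↑↑ = kind-elb _ eq , inj₂ refl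
  enter _ _ (inj₁ ()) | _ | _ | _ | _ | _ | idle
  enter _ _ (inj₂ ()) | _ | _ | _ | _ | _ | idle
  enter _ _ (inj₁ ()) | _ | _ | _ | _ | _ | source→
  enter _ _ (inj₂ ()) | _ | _ | _ | _ | _ | source→
  enter _ _ (inj₁ ()) | _ | _ | _ | _ | _ | source↑
  enter _ _ (inj₂ ()) | _ | _ | _ | _ | _ | source↑

  emit : ∀ {i j} → i < k → j < n → W i j ≡ pivot → h i (suc j) ≡ true ⊎ v i j ≡ true
  emit {i} {j} i<k j<n p =
    emits (subst (λ κ → Rule κ (h i j) (v (suc i) j) (h i (suc j)) (v i j)) (cong kind p) (rule i<k j<n))
    where
    emits : ∀ {a b a' b'} → Rule piv a b a' b' → a' ≡ true ⊎ b' ≡ true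
    emits source→ = inj₁ refl
    emits source↑ = inj₂ refl

  -- By `rightEnd` a carry cannot leave the array, so it must meet a vertex within the `m` remaining
  -- columns.
  scanRight : ∀ {i} m c → c + m ≡ n → i < k → i < n → h i c ≡ true →
              ∃ λ c' → c ≤ c' × IsVtx n W i c' × h i c' ≡ true × (∀ d → c ≤ d → d < c' → ¬ IsVtx n W i d)
  scanRight zero c e i<k i<n a rewrite trans (sym (+-identityʳ c)) e =
    contradiction (trans (sym a) (rightEnd i<k)) λ ()
  scanRight {i} (suc m) c e i<k i<n a with vtx? {n} {W} i c
  ... | yes vx = c , ≤-refl , vx , a , λ d l l' → ⊥-elim (<⇒≱ l' l)
  ... | no nv = let c' , l , vx , a' , gap = scanRight m (suc c) (trans (sym (+-suc c m)) e) i<k i<n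
                                               (trans (proj₁ (pass-rule i<k c<n (¬vtx⇒pass i<n c<n nv))) a)
                in c' , <⇒≤ l , vx , a' , λ d → gap' c' gap d
    where
    c<n : c < n
    c<n = subst (suc c ≤_) (trans (sym (+-suc c m)) e) (m≤m+n (suc c) m)
    gap' : ∀ c' → (∀ d → suc c ≤ d → d < c' → ¬ IsVtx n W i d) → ∀ d → c ≤ d → d < c' → ¬ IsVtx n W i d
    gap' c' gap d l l' with m≤n⇒m<n∨m≡n l
    ... | inj₁ l″ = gap d l″ l'
    ... | inj₂ refl = nv

  nextRight : ∀ {i j} → i < k → i < n → j < n → h i (suc j) ≡ true →
              ∃ λ c → j < c × IsVtx n W i c × h i c ≡ true × (∀ d → j < d → d < c → ¬ IsVtx n W i d)
  nextRight {i} {j} i<k i<n j<n a = scanRight (n ∸ suc j) (suc j) (m+[n∸m]≡n j<n) i<k i<n a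

  nextUp : ∀ {j} r → r ≤ k → r ≤ n → j < n → v r j ≡ true →
           (∃ λ r' → r' < r × IsVtx n W r' j × v (suc r') j ≡ true × (∀ d → r' < d → d < r → ¬ IsVtx n W d j))
           ⊎ (v 0 j ≡ true × ∀ d → d < r → ¬ IsVtx n W d j)
  nextUp zero _ _ _ a = inj₂ (a , λ _ ())
  nextUp {j} (suc r) r<k r<n j<n a with vtx? {n} {W} r j
  ... | yes vx = inj₁ (r , ≤-refl , vx , a , λ d l l' → ⊥-elim (<⇒≱ l (s≤s⁻¹ l')))
  ... | no nv with nextUp r (<⇒≤ r<k) (<⇒≤ r<n) j<n
                     (trans (proj₂ (pass-rule r<k j<n (¬vtx⇒pass r<n j<n nv))) a)
  ...   | inj₁ (r' , l , vx , a' , gap) = inj₁ (r' , m<n⇒m<1+n l , vx , a' , gap')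
    where
    gap' : ∀ d → r' < d → d < suc r → ¬ IsVtx n W d j
    gap' d l (s≤s l') with m≤n⇒m<n∨m≡n l'
    ... | inj₁ l″ = gap d l l″
    ... | inj₂ refl = nv
  ...   | inj₂ (a' , gap) = inj₂ (a' , gap')
    where
    gap' : ∀ d → d < suc r → ¬ IsVtx n W d j
    gap' d (s≤s l') with m≤n⇒m<n∨m≡n l'
    ... | inj₁ l″ = gap d l″
    ... | inj₂ refl = nv

  -- By `bottomEnd` nothing enters the array from below, so a path seen in a column must have come
  -- out of a vertex lower in it. This supplies the low vertex that `crossing⇒coloop` asks for.
  vertexBelow : ∀ {j} m r → r + m ≡ k → k ≤ n → j < n → v r j ≡ true → ∃ λ r' → r ≤ r' × r' < k × IsVtx n W r' j
  vertexBelow zero r e _ j<n a rewrite trans (sym (+-identityʳ r)) e =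
    contradiction (trans (sym a) (bottomEnd j<n)) λ ()
  vertexBelow {j} (suc m) r e k≤n j<n a with vtx? {n} {W} r j
  ... | yes vx = r , ≤-refl , subst (suc r ≤_) (trans (sym (+-suc r m)) e) (m≤m+n (suc r) m) , vx
  ... | no nv = let r' , l , p = vertexBelow m (suc r) (trans (sym (+-suc r m)) e) k≤n j<n
                                   (trans (sym (proj₂ (pass-rule r<k j<n (¬vtx⇒pass (<-≤-trans r<k k≤n) j<n nv)))) a)
                in r' , <⇒≤ l , p
    where
    r<k : r < k
    r<k = subst (suc r ≤_) (trans (sym (+-suc r m)) e) (m≤m+n (suc r) m)

module FlowCollection {n k : ℕ} {W : Grid} {w : ℕ → ℕ} (net : Network n k W w)
                      {J : Subset n} (F : Flow n k W J) where
  open Network net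
  open Flow F
  open FlowScan F

  -- The flow is tested at the target end of an edge, where `not-both-in` makes predecessors unique.
  -- Box targets are elbows, so no line runs into a source.
  data Carried : Node → Node → Set where
    carry→ : ∀ {i j j'} → IsVtx n W i j → IsVtx n W i j' → W i j' ≡ elbow → j < j' →
             (∀ d → j < d → d < j' → ¬ IsVtx n W i d) → h i j' ≡ true → Carried (box i j) (box i j')
    carry↑ : ∀ {i i' j} → IsVtx n W i j → IsVtx n W i' j → W i' j ≡ elbow → i' < i →
             (∀ d → i' < d → d < i → ¬ IsVtx n W d j) → v (suc i') j ≡ true → Carried (box i j) (box i' j)
    carryOut : ∀ {i j} → IsVtx n W i j → (∀ d → d < i → ¬ IsVtx n W d j) → v 0 j ≡ true →
               Carried (box i j) (sink j)

  carried-edge : ∀ {x y} → Carried x y → Edge n W x y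
  carried-edge (carry→ s t e l gap _)  = right s t e l gap
  carried-edge (carry↑ s t _ l gap _)  = up s t l gap
  carried-edge (carryOut s gap _)      = upSink s gap

  carried-pred-unique : ∀ {x x' y} → Carried x y → Carried x' y → x ≡ x'
  carried-pred-unique (carry→ {j = j} s _ _ l gap _) (carry→ {j = j'} s' _ _ l' gap' _) with <-cmp j j'
  ... | tri< a _ _    = ⊥-elim (gap _ a l' s')
  ... | tri≈ _ refl _ = refl
  ... | tri> _ _ a    = ⊥-elim (gap' _ a l s)
  carried-pred-unique (carry→ _ t _ _ _ a) (carry↑ _ _ _ _ _ b) = ⊥-elim (not-both-in (inside t) t a b)
  carried-pred-unique (carry↑ _ _ _ _ _ b) (carry→ _ t _ _ _ a) = ⊥-elim (not-both-in (inside t) t a b)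
  carried-pred-unique (carry↑ {i = i} s _ _ l gap _) (carry↑ {i = i'} s' _ _ l' gap' _) with <-cmp i i'
  ... | tri< a _ _    = ⊥-elim (gap' _ l a s)
  ... | tri≈ _ refl _ = refl
  ... | tri> _ _ a    = ⊥-elim (gap _ l' a s')
  carried-pred-unique (carryOut {i} s gap _) (carryOut {i'} s' gap' _) with <-cmp i i'
  ... | tri< a _ _    = ⊥-elim (gap' _ a s)
  ... | tri≈ _ refl _ = refl
  ... | tri> _ _ a    = ⊥-elim (gap _ a s')

  not-carried-to-pivot : ∀ {i x} → i < k → ¬ Carried x (box i (w i))
  not-carried-to-pivot i<k (carry→ _ _ e _ _ _) = contradiction (trans (sym e) (pivotAt i<k)) λ ()
  not-carried-to-pivot i<k (carry↑ _ _ e _ _ _) = contradiction (trans (sym e) (pivotAt i<k)) λ ()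

  -- From i x: the flow line that starts at the source of row i visits x.
  data From (i : ℕ) : Node → Set where
    origin : i < k → From i (box i (w i))
    hop    : ∀ {x y} → From i x → Carried x y → From i y

  -- Tracing back is forced, since predecessors are unique and pivots have none. Hence the lines of
  -- different sources are disjoint.
  From-unique : ∀ {i i' x} → From i x → From i' x → i ≡ i'
  From-unique (origin _) (origin _) = refl
  From-unique (origin l) (hop _ c)  = ⊥-elim (not-carried-to-pivot l c)
  From-unique (hop _ c) (origin l)  = ⊥-elim (not-carried-to-pivot l c)
  From-unique (hop f c) (hop f' c') with carried-pred-unique c c'
  ... | refl = From-unique f f'

  next-carried : ∀ {i j} → IsVtx n W i j → h i (suc j) ≡ true ⊎ v i j ≡ true →
                 (∃₂ λ i' j' → Carried (box i j) (box i' j') × IsVtx n W i' j' ×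
                               (h i' (suc j') ≡ true ⊎ v i' j' ≡ true))
                 ⊎ Carried (box i j) (sink j)
  next-carried {i} {j} vx (inj₁ a) =
    let c , l , vx' , a' , gap = nextRight (inside vx) (proj₁ vx) (proj₁ (proj₂ vx)) a
        e , o = enter (inside vx') vx' (inj₁ a')
    in inj₁ (i , c , carry→ vx vx' e l gap a' , vx' , o)
  next-carried {i} {j} vx (inj₂ b) with nextUp i (<⇒≤ (inside vx)) (<⇒≤ (proj₁ vx)) (proj₁ (proj₂ vx)) b
  ... | inj₂ (b' , gap) = inj₂ (carryOut vx gap b')
  ... | inj₁ (r , l , vx' , b' , gap) =
    let e , o = enter (inside vx') vx' (inj₂ b') in inj₁ (r , j , carry↑ vx vx' e l gap b' , vx' , o)

  Trail : ℕ → Node → Set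
  Trail s x = ∃₂ λ t p → WalkTo n W t (x ∷ p) × (∀ {y} → y ∈ x ∷ p → From s y)

  -- The rank of a box is at most n + n, so m bounds the number of steps left.
  trail : ∀ {s i j} m → n + n < rank {n} {W} (box i j) + m → From s (box i j) → IsVtx n W i j →
          h i (suc j) ≡ true ⊎ v i j ≡ true → Trail s (box i j)
  trail {s} {i} {j} zero big _ vx _ =
    ⊥-elim (<⇒≱ big (subst (_≤ n + n) (sym (+-identityʳ _))
                       (+-mono-≤ (<⇒≤ (proj₁ (proj₂ vx))) (m∸n≤m n i))))
  trail {s} {i} {j} (suc m) big f vx o with next-carried vx o
  ... | inj₂ c = _ , _ , step (carried-edge c) end ,
                 λ { (here refl) → f ; (there (here refl)) → hop f c }
  ... | inj₁ (i' , j' , c , vx' , o')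
    with trail m (<-≤-trans big (subst (_≤ rank {n} {W} (box i' j') + m) (sym (+-suc _ m))
                                   (+-monoˡ-≤ m (edge-rank (carried-edge c))))) (hop f c) vx' o'
  ...   | t , p , wk , fr = t , _ , step (carried-edge c) wk ,
                            λ { (here refl) → f ; (there q) → fr q }

  fromSource : ∀ i → i < k → Trail i (box i (w i))
  fromSource i i<k = trail (suc (n + n)) (m≤n+m (suc (n + n)) _) (origin i<k) (vtx i<k)
                        (emit i<k (column< i<k) (pivotAt i<k))

  collection : AdmissibleCollection n W k
  collection = record
    { paths    = λ r → _ ∷ proj₁ (proj₂ (trails r))
    ; ends     = λ r → proj₁ (trails r)
    ; isPath   = λ r → toℕ r , w (toℕ r) , _ , refl , vtx (Finₚ.toℕ<n r) , pivotAt (Finₚ.toℕ<n r) ,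
                       proj₁ (proj₂ (proj₂ (trails r)))
    ; disjoint = λ r r' ne x m m' → ne (Finₚ.toℕ-injective
                   (From-unique (proj₂ (proj₂ (proj₂ (trails r))) m) (proj₂ (proj₂ (proj₂ (trails r'))) m')))
    }
    where
    trails : (r : Fin k) → Trail (toℕ r) (box (toℕ r) (w (toℕ r)))
    trails r = fromSource (toℕ r) (Finₚ.toℕ<n r)

  open AdmissibleCollection collection

  From-sink : ∀ {i t} → From i (sink t) → t < n × v 0 t ≡ true
  From-sink (hop _ (carryOut (_ , t<n , _) _ b)) = t<n , b

  From-end : ∀ r → From (toℕ r) (sink (ends r))
  From-end r = let _ , _ , wk , fr = fromSource (toℕ r) (Finₚ.toℕ<n r) in fr (walk-end wk)

  endFin : Fin k → Fin n
  endFin r = fromℕ< (proj₁ (From-sink (From-end r)))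

  toℕ-endFin : ∀ r → toℕ (endFin r) ≡ ends r
  toℕ-endFin r = Finₚ.toℕ-fromℕ< _

  endFin-injective : ∀ {r r'} → endFin r ≡ endFin r' → r ≡ r'
  endFin-injective {r} {r'} e = Finₚ.toℕ-injective (From-unique (From-end r)
    (subst (From (toℕ r') ∘ sink) (trans (sym (toℕ-endFin r')) (trans (cong toℕ (sym e)) (toℕ-endFin r)))
           (From-end r')))

  endFin∈J : ∀ r → endFin r S.∈ J
  endFin∈J r = lookup⇒[]= _ J (trans (sym (topEnd _))
    (trans (cong (v 0) (toℕ-endFin r)) (proj₂ (From-sink (From-end r)))))

  -- The `k` lines end in `k` different columns of `J`, and `J` has only `k` elements. This count
  -- spares tracing the flow back from every column of `J`.
  inB : S.∣ J ∣ ≡ k → InB n W k J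
  inB size = size , collection , λ j → mk⇔
    (λ j∈J → let r , e = injection-onto endFin J endFin-injective endFin∈J size j∈J
              in r , trans (sym (toℕ-endFin r)) (cong toℕ e))
    (λ (r , e) → subst (S._∈ J) (Finₚ.toℕ-injective (trans (toℕ-endFin r) e)) (endFin∈J r))

InB⇔Flow : ∀ {n k W w} → Network n k W w → ∀ J → InB n W k J ⇔ (S.∣ J ∣ ≡ k × Flow n k W J)
InB⇔Flow net J = mk⇔ (λ (size , C , iff) → size , CollectionFlow.flow net C iff)
                      (λ (size , F) → FlowCollection.inB net F size)

-- Pipes

next-top⇒bottom : ∀ t d → next t d ≡ just fromTop → hasBottom t ≡ true
next-top⇒bottom vert  fromTop  _ = refl
next-top⇒bottom cross fromTop  _ = refl
next-top⇒bottom elbow fromLeft _ = refl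

next-left⇒right : ∀ t d → next t d ≡ just fromLeft → hasRight t ≡ true
next-left⇒right pivot fromTop  _ = refl
next-left⇒right elbow fromTop  _ = refl
next-left⇒right horiz fromLeft _ = refl
next-left⇒right cross fromLeft _ = refl

module _ {n : ℕ} {E : Grid} where

  reach-≥ : ∀ {a i j d} → Reach n E a i j d → a ≤ i + j
  reach-≥ start                        = ≤-refl
  reach-≥ (down _ _ r _)               = m≤n⇒m≤1+n (reach-≥ r)
  reach-≥ {a} (right {i} {j} _ _ r _)  = subst (a ≤_) (sym (+-suc i j)) (m≤n⇒m≤1+n (reach-≥ r))

  -- Every step raises `i + j` by one, so a pipe visits each antidiagonal at most once; two
  -- positions on the same antidiagonal have predecessors on the same antidiagonal.
  reach-deterministic : ∀ {a i j d i' j' d'} → Reach n E a i j d → Reach n E a i' j' d' →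
                        i + j ≡ i' + j' → i ≡ i' × j ≡ j' × d ≡ d'
  reach-deterministic start start _ = refl , refl , refl
  reach-deterministic start (down _ _ r _) refl = ⊥-elim (<-irrefl refl (reach-≥ r))
  reach-deterministic start (right {i} {j} _ _ r _) refl =
    ⊥-elim (<-irrefl refl (subst (_≤ i + j) (+-suc i j) (reach-≥ r)))
  reach-deterministic (down _ _ r _) start refl = ⊥-elim (<-irrefl refl (reach-≥ r))
  reach-deterministic (right {i} {j} _ _ r _) start refl =
    ⊥-elim (<-irrefl refl (subst (_≤ i + j) (+-suc i j) (reach-≥ r)))
  reach-deterministic (down _ _ r e) (down _ _ r' e') s with reach-deterministic r r' (suc-injective s)
  ... | refl , refl , refl = refl , refl , refl
  reach-deterministic (right {i} {j} _ _ r e) (right {i'} {j'} _ _ r' e') s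
    with reach-deterministic r r' (suc-injective (trans (sym (+-suc i j)) (trans s (+-suc i' j'))))
  ... | refl , refl , refl = refl , refl , refl
  reach-deterministic (down _ _ r e) (right {i'} {j'} _ _ r' e') s
    with reach-deterministic r r' (suc-injective (trans s (+-suc i' j')))
  ... | refl , refl , refl = contradiction (trans (sym e) e') λ ()
  reach-deterministic (right {i} {j} _ _ r e) (down _ _ r' e') s
    with reach-deterministic r r' (suc-injective (trans (sym (+-suc i j)) s))
  ... | refl , refl , refl = contradiction (trans (sym e) e') λ ()

  reach-prefix : ∀ {a i j d} s → Reach n E a i j d → a ≤ s → s ≤ i + j →
                 ∃₂ λ i' j' → (∃ λ d' → Reach n E a i' j' d') × i' + j' ≡ s × i' ≤ i × j' ≤ j
  reach-prefix s r l l' with m≤n⇒m<n∨m≡n l'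
  reach-prefix s r l _ | inj₂ refl = _ , _ , (_ , r) , refl , ≤-refl , ≤-refl
  reach-prefix s start l _ | inj₁ s<a = ⊥-elim (<⇒≱ s<a l)
  reach-prefix s (down _ _ r _) l _ | inj₁ (s≤s l″) =
    let i' , j' , r' , e , p , q = reach-prefix s r l l″ in i' , j' , r' , e , m≤n⇒m≤1+n p , q
  reach-prefix s (right {i} {j} _ _ r _) l _ | inj₁ l″ =
    let i' , j' , r' , e , p , q = reach-prefix s r l (s≤s⁻¹ (subst (suc s ≤_) (+-suc i j) l″))
    in i' , j' , r' , e , p , m≤n⇒m≤1+n q

  -- Cut the longer of the two pieces of the pipe at the antidiagonal of the shorter; pipes only run
  -- down and right. This yields the column inequality of `NoTouchSEOfCrossing` from the row
  -- inequality.
  reach-monotone : ∀ {a i j d i' j' d'} → Reach n E a i j d → Reach n E a i' j' d' → i < i' → j ≤ j'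
  reach-monotone {i = i} {j} {i' = i'} {j'} r r' i<i' with ≤-total (i + j) (i' + j')
  ... | inj₁ l with reach-prefix (i + j) r' (reach-≥ r) l
  ...   | _ , _ , (_ , r″) , e , _ , q with reach-deterministic r r″ (sym e)
  ...     | refl , refl , refl = q
  reach-monotone {i = i} {j} {i' = i'} {j'} r r' i<i' | inj₂ l with reach-prefix (i' + j') r (reach-≥ r') l
  ...   | _ , _ , (_ , r″) , e , p , _ with reach-deterministic r' r″ (sym e)
  ...     | refl , refl , refl = ⊥-elim (<⇒≱ i<i' p)

  fromAbove : ∀ {x i c} → Reach n E x (suc i) c fromTop →
              (Reach n E x i c fromTop × (E i c ≡ vert ⊎ E i c ≡ cross)) ⊎ (Reach n E x i c fromLeft × E i c ≡ elbow)
  fromAbove {x} {i} {c} (down {d = d} i<n c<n r e) with E i c | d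
  fromAbove (down i<n c<n r refl) | vert  | fromTop  = inj₁ (r , inj₁ refl)
  fromAbove (down i<n c<n r refl) | cross | fromTop  = inj₁ (r , inj₂ refl)
  fromAbove (down i<n c<n r refl) | elbow | fromLeft = inj₂ (r , refl)

  TurnedAt : ℕ → ℕ → ℕ → Set
  TurnedAt y i c = ∃ λ c₀ → c₀ < c × IsVtx n E i c₀ × Reach n E y i c₀ fromTop ×
                            (∀ d → c₀ < d → d ≤ c → Reach n E y i d fromLeft) ×
                            (∀ d → c₀ < d → d < c → ¬ IsVtx n E i d)

  traceLeft : ∀ {y i c} → Reach n E y i c fromLeft → TurnedAt y i c
  traceLeft {y} {i} {suc c} r₀@(right {d = d} i<n c<n r e) = go (E i c) d refl r e
    where
    base : E i c ≡ pivot ⊎ E i c ≡ elbow → Reach n E y i c fromTop → TurnedAt y i (suc c)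
    base t r = c , ≤-refl , (i<n , c<n , t) , r ,
               (λ d l l' → subst (λ d → Reach n E y i d fromLeft) (≤-antisym l l') r₀) ,
               (λ d l l' → ⊥-elim (<⇒≱ l (s≤s⁻¹ l')))
    more : kind (E i c) ≡ pass → Reach n E y i c fromLeft → TurnedAt y i (suc c)
    more ps r with traceLeft r
    ... | c₀ , l , vx , top , along , gap = c₀ , m<n⇒m<1+n l , vx , top , along' , gap'
      where
      along' : ∀ d → c₀ < d → d ≤ suc c → Reach n E y i d fromLeft
      along' d l l' with m≤n⇒m<n∨m≡n l'
      ... | inj₁ (s≤s l″) = along d l l″
      ... | inj₂ refl = r₀
      gap' : ∀ d → c₀ < d → d < suc c → ¬ IsVtx n E i d
      gap' d l (s≤s l') with m≤n⇒m<n∨m≡n l'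
      ... | inj₁ l″ = gap d l l″
      ... | inj₂ refl = pass⇒¬vtx {W = E} ps
    go : ∀ t d → E i c ≡ t → Reach n E y i c d → next t d ≡ just fromLeft → TurnedAt y i (suc c)
    go pivot fromTop  e r _ = base (inj₁ e) r
    go elbow fromTop  e r _ = base (inj₂ e) r
    go horiz fromLeft e r _ = more (cong kind e) r
    go cross fromLeft e r _ = more (cong kind e) r

Meets : ℕ → Grid → ℕ → ℕ → ℕ → ℕ → Set
Meets n E x y i j = Crosses n E x y i j ⊎ Touches n E x y i j

Meets-sym : ∀ {n E x y i j} → Meets n E x y i j → Meets n E y x i j
Meets-sym (inj₁ (inj₁ m)) = inj₁ (inj₂ m)
Meets-sym (inj₁ (inj₂ m)) = inj₁ (inj₁ m)
Meets-sym (inj₂ (inj₁ m)) = inj₂ (inj₂ m)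
Meets-sym (inj₂ (inj₂ m)) = inj₂ (inj₁ m)

module Pipes {n : ℕ} {E : Grid} {u v : ℕ → ℕ} (fpp : IsFPP n E u v) where

  permutation : IsPermutation n u
  permutation = proj₁ (proj₁ fpp)

  pipes : PipesTopToRight n E
  pipes = proj₁ (proj₂ (proj₁ fpp))

  pivotAt : ∀ i → i < n → E i (u i) ≡ pivot
  pivotAt = proj₁ (proj₂ (proj₂ (proj₁ fpp)))

  tiles = proj₂ (proj₂ (proj₂ (proj₁ fpp)))

  inverse : ∀ {j} → j < n → ∃ λ i → i < n × u i ≡ j
  inverse {j} j<n with injection-onto (λ r → fromℕ< (proj₁ permutation (toℕ r) (Finₚ.toℕ<n r)))
                                      S.⊤ inj (λ _ → ∈⊤) (∣⊤∣≡n n) {fromℕ< j<n} ∈⊤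
    where
    inj : ∀ {r r' : Fin n} → fromℕ< (proj₁ permutation (toℕ r) (Finₚ.toℕ<n r)) ≡
                             fromℕ< (proj₁ permutation (toℕ r') (Finₚ.toℕ<n r')) → r ≡ r'
    inj {r} {r'} e = Finₚ.toℕ-injective (proj₂ permutation _ _ (Finₚ.toℕ<n r) (Finₚ.toℕ<n r')
      (trans (sym (Finₚ.toℕ-fromℕ< _)) (trans (cong toℕ e) (Finₚ.toℕ-fromℕ< _))))
  ... | r , e = toℕ r , Finₚ.toℕ<n r , trans (sym (Finₚ.toℕ-fromℕ< _)) (trans (cong toℕ e) (Finₚ.toℕ-fromℕ< j<n))

  data Cell (i j : ℕ) : Set where
    emptyLeft   : InvBefore u i j → j < u i → E i j ≡ empty → Cell i j
    vertLeft    : InvAfter n u i j → j < u i → E i j ≡ vert → Cell i j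
    atPivot     : j ≡ u i → E i j ≡ pivot → Cell i j
    horizRight  : InvBefore u i j → u i < j → E i j ≡ horiz → Cell i j
    crossRight  : InvAfter n u i j → u i < j → E i j ≡ cross → Cell i j
    elbowRight  : InvAfter n u i j → u i < j → E i j ≡ elbow → Cell i j

  cell : ∀ {i j} → i < n → j < n → Cell i j
  cell {i} {j} i<n j<n with inverse j<n
  ... | i' , i'<n , e with <-cmp i' i | <-cmp j (u i)
  ... | tri≈ _ refl _ | _ = atPivot (sym e) (subst (λ c → E i c ≡ pivot) e (pivotAt i i<n))
  ... | tri< l _ _ | tri< l' _ _ = emptyLeft (i' , l , e) l' (proj₁ tiles i j i<n j<n (i' , l , e) l')
  ... | tri< l _ _ | tri> _ _ l' = horizRight (i' , l , e) l' (proj₁ (proj₂ tiles) i j i<n j<n (i' , l , e) l')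
  ... | tri< l _ _ | tri≈ _ q _ = ⊥-elim (<⇒≢ l (proj₂ permutation i' i i'<n i<n (trans e q)))
  ... | tri> _ _ l | tri≈ _ q _ = ⊥-elim (>⇒≢ l (proj₂ permutation i' i i'<n i<n (trans e q)))
  ... | tri> _ _ l | tri< l' _ _ =
    vertLeft (i' , l , i'<n , e) l' (proj₁ (proj₂ (proj₂ tiles)) i j i<n j<n (i' , l , i'<n , e) l')
  ... | tri> _ _ l | tri> _ _ l' with proj₂ (proj₂ (proj₂ tiles)) i j i<n j<n (i' , l , i'<n , e) l'
  ...   | inj₁ x = crossRight (i' , l , i'<n , e) l' x
  ...   | inj₂ x = elbowRight (i' , l , i'<n , e) l' x

  top-of : ∀ {a i j} → i < n → j < n → Reach n E a i j fromTop → hasTop (E i j) ≡ true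
  top-of i<n j<n start = proj₁ pipes _ j<n
  top-of i<n j<n (down {i} {j} {d} i'<n _ r e) =
    trans (sym (proj₂ (proj₂ (proj₂ (proj₂ (proj₂ pipes)))) i j i<n j<n)) (next-top⇒bottom (E i j) d e)

  left-of : ∀ {a i j} → i < n → j < n → Reach n E a i j fromLeft → hasLeft (E i j) ≡ true
  left-of i<n j<n (right {i} {j} {d} _ j'<n r e) =
    trans (sym (proj₁ (proj₂ (proj₂ (proj₂ (proj₂ pipes)))) i j i<n j<n)) (next-left⇒right (E i j) d e)

  -- The strand is followed backwards. Matching sides allow each step, and no strand meets the left
  -- edge of the array, so the trace ends on the top edge.
  pipeFromTop  : ∀ i j → i < n → j < n → hasTop (E i j) ≡ true → ∃ λ a → Reach n E a i j fromTop
  pipeFromLeft : ∀ i j → i < n → j < n → hasLeft (E i j) ≡ true → ∃ λ a → Reach n E a i j fromLeft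

  pipeFromTop zero    j _   j<n _ = j , start
  pipeFromTop (suc i) j i<n j<n t
    with E i j in eq | proj₂ (proj₂ (proj₂ (proj₂ (proj₂ pipes)))) i j i<n j<n
  ... | vert  | _ = let a , r = pipeFromTop i j (<⇒≤ i<n) j<n (cong hasTop eq)
                    in a , down (<⇒≤ i<n) j<n r (cong (λ t → next t fromTop) eq)
  ... | cross | _ = let a , r = pipeFromTop i j (<⇒≤ i<n) j<n (cong hasTop eq)
                    in a , down (<⇒≤ i<n) j<n r (cong (λ t → next t fromTop) eq)
  ... | elbow | _ = let a , r = pipeFromLeft i j (<⇒≤ i<n) j<n (cong hasLeft eq)
                    in a , down (<⇒≤ i<n) j<n r (cong (λ t → next t fromLeft) eq)
  ... | empty | e = contradiction (trans e t) λ ()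
  ... | horiz | e = contradiction (trans e t) λ ()
  ... | pivot | e = contradiction (trans e t) λ ()

  pipeFromLeft i zero    i<n _   t = contradiction (trans (sym t) (proj₁ (proj₂ (proj₂ pipes)) i i<n)) λ ()
  pipeFromLeft i (suc j) i<n j<n t
    with E i j in eq | proj₁ (proj₂ (proj₂ (proj₂ (proj₂ pipes)))) i j i<n j<n
  ... | horiz | _ = let a , r = pipeFromLeft i j i<n (<⇒≤ j<n) (cong hasLeft eq)
                    in a , right i<n (<⇒≤ j<n) r (cong (λ t → next t fromLeft) eq)
  ... | cross | _ = let a , r = pipeFromLeft i j i<n (<⇒≤ j<n) (cong hasLeft eq)
                    in a , right i<n (<⇒≤ j<n) r (cong (λ t → next t fromLeft) eq)
  ... | elbow | _ = let a , r = pipeFromTop i j i<n (<⇒≤ j<n) (cong hasTop eq)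
                    in a , right i<n (<⇒≤ j<n) r (cong (λ t → next t fromTop) eq)
  ... | pivot | _ = let a , r = pipeFromTop i j i<n (<⇒≤ j<n) (cong hasTop eq)
                    in a , right i<n (<⇒≤ j<n) r (cong (λ t → next t fromTop) eq)
  ... | empty | e = contradiction (trans e t) λ ()
  ... | vert  | e = contradiction (trans e t) λ ()

  Apart : ℕ → ℕ → ℕ → Set
  Apart ρ x y = ∀ r c → ρ ≤ r → ¬ Meets n E x y r c

  Apart-suc : ∀ {ρ x y} → Apart ρ x y → Apart (suc ρ) x y
  Apart-suc ap r c l = ap r c (<⇒≤ l)

  -- Membership in a set of marks is undecided and `turner` yields it only up to double negation;
  -- the goal, being a negation, absorbs that.
  Apart-stable : ∀ {ρ x y} → ¬ ¬ Apart ρ x y → Apart ρ x y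
  Apart-stable nn r c l m = nn λ ap → ap r c l m

  -- Reducedness forbids a second crossing, and the condition on touching forbids a later common
  -- elbow. Starting one row lower leaves out the crossing itself and makes `reach-monotone`
  -- applicable.
  crosses⇒Apart : ∀ {x y r c} → Crosses n E x y r c → Apart (suc r) x y
  crosses⇒Apart cr r' c' l (inj₁ cr') = <⇒≢ l (proj₁ (proj₁ (proj₂ fpp) _ _ _ _ _ _ cr cr'))
  crosses⇒Apart {x} {y} {r} {c} cr r' c' l (inj₂ to) =
    proj₂ (proj₂ (proj₂ fpp)) _ _ _ _ _ _ cr to
      (<⇒≤ l , reach-monotone (proj₂ (x-crosses cr)) (proj₂ (x-touches to)) l)
    where
    x-crosses : Crosses n E x y r c → ∃ λ d → Reach n E x r c d
    x-crosses (inj₁ (_ , _ , _ , p , _)) = _ , p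
    x-crosses (inj₂ (_ , _ , _ , _ , p)) = _ , p
    x-touches : Touches n E x y r' c' → ∃ λ d → Reach n E x r' c' d
    x-touches (inj₁ (_ , _ , _ , p , _)) = _ , p
    x-touches (inj₂ (_ , _ , _ , _ , p)) = _ , p

  meet : ∀ {x y i j} → i < n → j < n → Reach n E x i j fromTop → Reach n E y i j fromLeft →
         Meets n E x y i j
  meet {x} {y} {i} {j} i<n j<n p q with E i j | top-of i<n j<n p | left-of i<n j<n q
  ... | cross | _ | _ = inj₁ (inj₁ (i<n , j<n , refl , p , q))
  ... | elbow | _ | _ = inj₂ (inj₁ (i<n , j<n , refl , p , q))

  meet-nonvertex : ∀ {x y i j} → i < n → j < n → Reach n E x i j fromTop → Reach n E y i j fromLeft →
                   ¬ IsVtx n E i j → Apart (suc i) x y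
  meet-nonvertex i<n j<n p q nv with meet i<n j<n p q
  ... | inj₁ cr = crosses⇒Apart cr
  ... | inj₂ (inj₁ (_ , _ , e , _)) = ⊥-elim (nv (i<n , j<n , inj₂ e))
  ... | inj₂ (inj₂ (_ , _ , e , _)) = ⊥-elim (nv (i<n , j<n , inj₂ e))

  rightCell : ∀ {i j} → i < n → j < n → u i < j → E i j ≡ horiz ⊎ E i j ≡ cross ⊎ E i j ≡ elbow
  rightCell i<n j<n l with cell i<n j<n
  ... | emptyLeft _ l' _   = ⊥-elim (<-asym l l')
  ... | vertLeft _ l' _    = ⊥-elim (<-asym l l')
  ... | atPivot e _        = ⊥-elim (<⇒≢ l (sym e))
  ... | horizRight _ _ e   = inj₁ e
  ... | crossRight _ _ e   = inj₂ (inj₁ e)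
  ... | elbowRight _ _ e   = inj₂ (inj₂ e)

  hasLeft⇒right : ∀ {i j} → i < n → j < n → hasLeft (E i j) ≡ true → u i < j
  hasLeft⇒right i<n j<n t with cell i<n j<n
  ... | emptyLeft _ _ e    = contradiction (trans (sym t) (cong hasLeft e)) λ ()
  ... | vertLeft _ _ e     = contradiction (trans (sym t) (cong hasLeft e)) λ ()
  ... | atPivot _ e        = contradiction (trans (sym t) (cong hasLeft e)) λ ()
  ... | horizRight _ l _   = l
  ... | crossRight _ l _   = l
  ... | elbowRight _ l _   = l

  vtx⇒right : ∀ {i j} → IsVtx n E i j → u i ≤ j
  vtx⇒right (i<n , j<n , t) with cell i<n j<n | t
  ... | emptyLeft _ _ e    | inj₁ e' = contradiction (trans (sym e) e') λ ()
  ... | emptyLeft _ _ e    | inj₂ e' = contradiction (trans (sym e) e') λ ()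
  ... | vertLeft _ _ e     | inj₁ e' = contradiction (trans (sym e) e') λ ()
  ... | vertLeft _ _ e     | inj₂ e' = contradiction (trans (sym e) e') λ ()
  ... | atPivot e _        | _ = ≤-reflexive (sym e)
  ... | horizRight _ l _   | _ = <⇒≤ l
  ... | crossRight _ l _   | _ = <⇒≤ l
  ... | elbowRight _ l _   | _ = <⇒≤ l

  pivot⇒u : ∀ {i j} → i < n → j < n → E i j ≡ pivot → j ≡ u i
  pivot⇒u i<n j<n t with cell i<n j<n
  ... | emptyLeft _ _ e    = contradiction (trans (sym t) e) λ ()
  ... | vertLeft _ _ e     = contradiction (trans (sym t) e) λ ()
  ... | atPivot e _        = e
  ... | horizRight _ _ e   = contradiction (trans (sym t) e) λ ()
  ... | crossRight _ _ e   = contradiction (trans (sym t) e) λ ()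
  ... | elbowRight _ _ e   = contradiction (trans (sym t) e) λ ()

  goDown : ∀ {a i j} → i < n → j < n → Reach n E a i j fromTop → E i j ≢ pivot →
           ∃ λ b → Reach n E b (suc i) j fromTop
  goDown {a} {i} {j} i<n j<n r np with E i j in eq | top-of i<n j<n r
  ... | vert  | _ = a , down i<n j<n r (cong (λ t → next t fromTop) eq)
  ... | cross | _ = a , down i<n j<n r (cong (λ t → next t fromTop) eq)
  ... | elbow | _ = let b , r' = pipeFromLeft i j i<n j<n (cong hasLeft eq)
                    in b , down i<n j<n r' (cong (λ t → next t fromLeft) eq)
  ... | pivot | _ = ⊥-elim (np refl)

  vtx-pipe : ∀ {i j} → IsVtx n E i j → ∃ λ a → Reach n E a i j fromTop × Reach n E a i (suc j) fromLeft
  vtx-pipe (i<n , j<n , inj₁ e) = let a , r = pipeFromTop _ _ i<n j<n (cong hasTop e)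
                                  in a , r , right i<n j<n r (cong (λ t → next t fromTop) e)
  vtx-pipe (i<n , j<n , inj₂ e) = let a , r = pipeFromTop _ _ i<n j<n (cong hasTop e)
                                  in a , r , right i<n j<n r (cong (λ t → next t fromTop) e)

  goRight : ∀ {p i} m c → i < n → c + m < n → Reach n E p i c fromLeft →
            (∀ d → c ≤ d → d < c + m → E i d ≢ elbow) → ∀ d → c ≤ d → d ≤ c + m → Reach n E p i d fromLeft
  goRight {p} {i} zero c i<n lt r _ d l l' =
    subst (λ d → Reach n E p i d fromLeft) (≤-antisym l (subst (d ≤_) (+-identityʳ c) l')) r
  goRight {p} {i} (suc m) c i<n lt r ne d l l' with m≤n⇒m<n∨m≡n l
  ... | inj₂ refl = r
  ... | inj₁ l″ = goRight m (suc c) i<n (subst (_< n) (+-suc c m) lt) one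
                    (λ d l l' → ne d (<⇒≤ l) (subst (d <_) (sym (+-suc c m)) l')) d l″ (subst (d ≤_) (+-suc c m) l')
    where
    c<n : c < n
    c<n = ≤-<-trans (m≤m+n c (suc m)) lt
    one : Reach n E p i (suc c) fromLeft
    one with rightCell i<n c<n (hasLeft⇒right i<n c<n (left-of i<n c<n r))
    ... | inj₁ e        = right i<n c<n r (cong (λ t → next t fromLeft) e)
    ... | inj₂ (inj₁ e) = right i<n c<n r (cong (λ t → next t fromLeft) e)
    ... | inj₂ (inj₂ e) = ⊥-elim (ne c ≤-refl (m<m+n c (s≤s z≤n)) e)

  -- The pipe p crossing at (i , c₀) would descend at such an elbow and meet in row
  -- suc i a pipe it has already crossed in row i.
  noElbowRightOfCross : ∀ {i c₀} → suc i < n → E i c₀ ≡ cross → IsVtx n E (suc i) c₀ →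
                        ∀ m d → c₀ < d → d < c₀ + m → d < n → E i d ≢ elbow
  noElbowRightOfCross {i} {c₀} si<n cr vx zero d l l' _ _ = <⇒≱ l (<⇒≤ (subst (d <_) (+-identityʳ c₀) l'))
  noElbowRightOfCross {i} {c₀} si<n cr vx@(_ , c₀<n , _) (suc m) c l l' c<n el =
    fromBelow (pipeFromLeft (suc i) c si<n c<n
      (rightHasLeft (rightCell si<n c<n (≤-<-trans (vtx⇒right vx) l))))
    where
    i<n = <⇒≤ si<n
    c≡ : c₀ + (c ∸ c₀) ≡ c
    c≡ = m+[n∸m]≡n (<⇒≤ l)
    earlier : ∀ d → c₀ ≤ d → d < c → E i d ≢ elbow
    earlier d p q e with m≤n⇒m<n∨m≡n p
    ... | inj₂ refl = contradiction (trans (sym cr) e) λ ()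
    ... | inj₁ p' = noElbowRightOfCross si<n cr vx m d p'
                      (<-≤-trans q (s≤s⁻¹ (subst (c <_) (+-suc c₀ m) l'))) (<-trans q c<n) e
    rightHasLeft : E (suc i) c ≡ horiz ⊎ E (suc i) c ≡ cross ⊎ E (suc i) c ≡ elbow → hasLeft (E (suc i) c) ≡ true
    rightHasLeft (inj₁ e)        = cong hasLeft e
    rightHasLeft (inj₂ (inj₁ e)) = cong hasLeft e
    rightHasLeft (inj₂ (inj₂ e)) = cong hasLeft e
    P = pipeFromLeft i c₀ i<n c₀<n (cong hasLeft cr)
    p = proj₁ P
    along : ∀ d → c₀ ≤ d → d ≤ c → Reach n E p i d fromLeft
    along d a b = goRight (c ∸ c₀) c₀ i<n (subst (_< n) (sym c≡) c<n) (proj₂ P)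
                    (λ d a b → earlier d a (subst (d <_) c≡ b)) d a (subst (d ≤_) (sym c≡) b)
    pDown : Reach n E p (suc i) c fromTop
    pDown = down i<n c<n (along c (<⇒≤ l) ≤-refl) (cong (λ t → next t fromLeft) el)
    fromBelow : ¬ ∃ λ q → Reach n E q (suc i) c fromLeft
    fromBelow (q , r) with traceLeft r
    ... | c₁ , c₁<c , _ , top , _ , gap = apart (fromAbove top)
      where
      -- The vertex below the cross would have stopped the run of `q`. So `q` came down through row
      -- `i` inside the horizontal run of `p` and crossed it there.
      c₀≤c₁ : c₀ ≤ c₁
      c₀≤c₁ = ≮⇒≥ λ c₁<c₀ → gap c₀ c₁<c₀ l vx
      apart : ¬ ((Reach n E q i c₁ fromTop × (E i c₁ ≡ vert ⊎ E i c₁ ≡ cross)) ⊎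
                 (Reach n E q i c₁ fromLeft × E i c₁ ≡ elbow))
      apart (inj₂ (_ , e)) = earlier c₁ c₀≤c₁ c₁<c e
      apart (inj₁ (r' , t)) = meet-nonvertex i<n (<-trans c₁<c c<n) r' (along c₁ c₀≤c₁ (<⇒≤ c₁<c)) (nv t)
                                (suc i) c ≤-refl (Meets-sym (meet si<n c<n pDown r))
        where
        nv : E i c₁ ≡ vert ⊎ E i c₁ ≡ cross → ¬ IsVtx n E i c₁
        nv (inj₁ e) = pass⇒¬vtx {W = E} (cong kind e)
        nv (inj₂ e) = pass⇒¬vtx {W = E} (cong kind e)

-- Vertical edges used by every flow

module Coloops {n k : ℕ} {E : Grid} {u v : ℕ → ℕ} (fpp : IsFPP n E u v) (k≤n : k ≤ n)
               {W : Grid} {J : Subset n} (F : Flow n k W J) (ρ₀ : ℕ)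
               (agree : ∀ {i j} → ρ₀ ≤ i → i < k → j < n → W i j ≡ E i j) where
  open Pipes fpp
  open Flow F using (h) renaming (v to vert-flow)
  open FlowScan F

  toE : ∀ {i j} → ρ₀ ≤ i → i < k → IsVtx n W i j → IsVtx n E i j
  toE l i<k (i<n , j<n , t) = i<n , j<n , subst (λ t → t ≡ pivot ⊎ t ≡ elbow) (agree l i<k j<n) t

  fromE : ∀ {i j} → ρ₀ ≤ i → i < k → IsVtx n E i j → IsVtx n W i j
  fromE l i<k (i<n , j<n , t) = i<n , j<n , subst (λ t → t ≡ pivot ⊎ t ≡ elbow) (sym (agree l i<k j<n)) t

  -- For a set Q of marked columns: no pipe entering row ρ in an unmarked column
  -- c ≥ j meets, from row ρ on, the pipe of a marked column to the right of c.
  Separated : (ℕ → Set) → ℕ → ℕ → Set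
  Separated Q j ρ = ∀ {c c' x y} → j ≤ c → c < c' → c' < n → ¬ Q c → Q c' →
                    Reach n E x ρ c fromTop → Reach n E y ρ c' fromTop → Apart ρ x y

  -- Keeps out columns whose pivot has been passed, where `Separated` would hold vacuously.
  Alive : (ℕ → Set) → ℕ → Set
  Alive Q ρ = ∀ {c} → c < n → Q c → ∃ λ y → Reach n E y ρ c fromTop

  module _ {Q : ℕ → Set} {j ρ : ℕ} (ρ<n : ρ < n) (sep : Separated Q j ρ) (alive : Alive Q ρ) where

    -- A pipe `x` from an unmarked column heads right towards the marked column `c'`. If it descends
    -- at an elbow `d` on the way, the pipe `z` from above turns right there and takes its place;
    -- `d` is unmarked, since `x` meets `z`. So some such pipe arrives at `c'` and meets the marked
    -- pipe.
    blocked : ∀ {c'} → c' < n → Q c' → ∀ m d {x cₓ} → d + m ≡ c' → j ≤ cₓ → cₓ < d → ¬ Q cₓ →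
              Reach n E x ρ cₓ fromTop → Reach n E x ρ d fromLeft → ⊥
    blocked {c'} c'<n q zero d e l l' nq top left rewrite trans (sym (+-identityʳ d)) e =
      sep l l' c'<n nq q top (proj₂ (alive c'<n q)) ρ c' ≤-refl
        (Meets-sym (meet ρ<n c'<n (proj₂ (alive c'<n q)) left))
    blocked {c'} c'<n q (suc m) d {x} {cₓ} e l l' nq top left =
      go (rightCell ρ<n d<n (hasLeft⇒right ρ<n d<n (left-of ρ<n d<n left)))
      where
      d<n : d < n
      d<n = <-trans (subst (d <_) e (m<m+n d (s≤s z≤n))) c'<n
      keep : next (E ρ d) fromLeft ≡ just fromLeft → ⊥
      keep t = blocked c'<n q m (suc d) (trans (sym (+-suc d m)) e) l (m<n⇒m<1+n l') nq top (right ρ<n d<n left t)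
      go : E ρ d ≡ horiz ⊎ E ρ d ≡ cross ⊎ E ρ d ≡ elbow → ⊥
      go (inj₁ t)        = keep (cong (λ t → next t fromLeft) t)
      go (inj₂ (inj₁ t)) = keep (cong (λ t → next t fromLeft) t)
      go (inj₂ (inj₂ t)) with vtx-pipe (ρ<n , d<n , inj₂ t)
      ... | z , topᶻ , leftᶻ = blocked c'<n q m (suc d) (trans (sym (+-suc d m)) e) (<⇒≤ (≤-<-trans l l')) ≤-refl
                                 (λ qd → sep l l' d<n nq qd top topᶻ ρ d ≤-refl (Meets-sym (meet ρ<n d<n topᶻ left)))
                                 topᶻ leftᶻ

    -- At a vertex the pipe of column `c` would turn right and head for `c'`, which `blocked`
    -- excludes.
    unmarkedNotVtx : ∀ {c c'} → j ≤ c → ¬ Q c → c < c' → c' < n → Q c' → ¬ IsVtx n E ρ c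
    unmarkedNotVtx {c} {c'} l nq c<c' c'<n q vx with vtx-pipe vx
    ... | x , top , left = blocked c'<n q (c' ∸ suc c) (suc c) (m+[n∸m]≡n c<c') l ≤-refl nq top left

    -- The marks for the row below ρ: the pipe turning right at a marked vertex of
    -- row ρ descends again at the next elbow.
    New Marked : ℕ → Set
    New c    = E ρ c ≡ elbow × ∃ λ c₀ → c₀ < c × Q c₀ × IsVtx n E ρ c₀ × (∀ d → c₀ < d → d < c → ¬ IsVtx n E ρ d)
    Marked c = (Q c × c ≢ u ρ) ⊎ New c

    nearest-unique : ∀ {c a b} → IsVtx n E ρ a → IsVtx n E ρ b → a < c → b < c →
                     (∀ d → a < d → d < c → ¬ IsVtx n E ρ d) → (∀ d → b < d → d < c → ¬ IsVtx n E ρ d) → a ≡ b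
    nearest-unique {c} {a} {b} va vb a<c b<c ga gb with <-cmp a b
    ... | tri< l _ _ = ⊥-elim (ga b l b<c vb)
    ... | tri≈ _ e _ = e
    ... | tri> _ _ l = ⊥-elim (gb a l a<c va)

    -- The pipe `x` comes straight down, as column `c` has no vertex in row `ρ`. If `y` does so too,
    -- the old separation applies. Otherwise `y` turned right at some `c₀`: left of `c` it crosses
    -- `x` in row `ρ` and is apart from it afterwards; right of `c` the column `c₀` is marked and
    -- the old separation applies again.
    separated-next : Separated Marked j (suc ρ)
    separated-next {c} {c'} {x} {y} l c<c' c'<n nm m rx ry = result
      where
      c<n : c < n
      c<n = <-trans c<c' c'<n
      c≢u : c ≢ u ρ
      c≢u refl with fromAbove rx
      ... | inj₁ (_ , inj₁ t) = contradiction (trans (sym t) (pivotAt ρ ρ<n)) λ ()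
      ... | inj₁ (_ , inj₂ t) = contradiction (trans (sym t) (pivotAt ρ ρ<n)) λ ()
      ... | inj₂ (_ , t) = contradiction (trans (sym t) (pivotAt ρ ρ<n)) λ ()
      nq : ¬ Q c
      nq q = nm (inj₁ (q , c≢u))
      notVtx : Marked c' → ¬ IsVtx n E ρ c
      notVtx (inj₁ (q , _)) vx = unmarkedNotVtx l nq c<c' c'<n q vx
      notVtx (inj₂ (_ , c₀ , c₀<c' , q , _ , gap)) vx with <-cmp c c₀
      ... | tri< lt _ _   = unmarkedNotVtx l nq lt (<-trans c₀<c' c'<n) q vx
      ... | tri≈ _ refl _ = nq q
      ... | tri> _ _ gt   = gap c gt c<c' vx
      xTop : Reach n E x ρ c fromTop
      xTop with fromAbove rx
      ... | inj₁ (r , _) = r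
      ... | inj₂ (_ , t) = ⊥-elim (notVtx m (ρ<n , c<n , inj₂ t))
      -- Here `c₀` is the last vertex before `c'`. For a new mark it is the vertex that produced the
      -- mark; for an old mark it is a vertex left of a marked column, which cannot be unmarked.
      turner : Marked c' → ∀ {c₀} → c < c₀ → c₀ < c' → IsVtx n E ρ c₀ →
               (∀ d → c₀ < d → d < c' → ¬ IsVtx n E ρ d) → ¬ ¬ Q c₀
      turner (inj₁ (q , _)) lt lt' vx gap nq₀ = unmarkedNotVtx (<⇒≤ (≤-<-trans l lt)) nq₀ lt' c'<n q vx
      turner (inj₂ (_ , c₁ , lt₁ , q , vx₁ , gap₁)) lt lt' vx gap nq₀ =
        nq₀ (subst Q (nearest-unique vx₁ vx lt₁ lt' gap₁ gap) q)
      fromNonvertex : Marked c' → ¬ IsVtx n E ρ c' → Reach n E y ρ c' fromTop → Apart (suc ρ) x y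
      fromNonvertex (inj₁ (q , _)) _ r = Apart-suc (sep l c<c' c'<n nq q xTop r)
      fromNonvertex (inj₂ (t , _)) nv _ = ⊥-elim (nv (ρ<n , c'<n , inj₂ t))
      result : Apart (suc ρ) x y
      result with fromAbove ry
      ... | inj₁ (r , inj₁ t) = fromNonvertex m (pass⇒¬vtx {W = E} (cong kind t)) r
      ... | inj₁ (r , inj₂ t) = fromNonvertex m (pass⇒¬vtx {W = E} (cong kind t)) r
      ... | inj₂ (r , _) with traceLeft r
      ...   | c₀ , c₀<c' , vx , top , along , gap with <-cmp c₀ c
      ...     | tri< lt _ _   = meet-nonvertex ρ<n c<n xTop (along c lt (<⇒≤ c<c')) (notVtx m)
      ...     | tri≈ _ refl _ = ⊥-elim (notVtx m vx)
      ...     | tri> _ _ gt   = Apart-stable λ na → turner m gt c₀<c' vx gap λ q₀ →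
                                  na (Apart-suc (sep l gt (<-trans c₀<c' c'<n) nq q₀ xTop top))

    alive-next : Alive Marked (suc ρ)
    alive-next c<n (inj₁ (q , c≢u)) = goDown ρ<n c<n (proj₂ (alive c<n q)) (c≢u ∘ pivot⇒u ρ<n c<n)
    alive-next c<n (inj₂ (t , _)) =
      goDown ρ<n c<n (proj₂ (pipeFromTop _ _ ρ<n c<n (cong hasTop t))) λ p → contradiction (trans (sym t) p) λ ()

  -- In a flow the path leaving a marked vertex of row ρ cannot go right, since by
  -- induction the next elbow of the row is entered from below.  A vertex to the
  -- left of all marks below row ρ keeps the marks from dying out.
  coloop : ∀ m ρ → ρ + m ≡ k → ρ₀ ≤ ρ → ∀ {Q j} → Separated Q j ρ → Alive Q ρ →
           (∃₂ λ r c → ρ ≤ r × r < k × j ≤ c × IsVtx n E r c × (∀ {c'} → Q c' → c < c')) →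
           ∀ {c'} → c' < n → Q c' → vert-flow ρ c' ≡ true
  -- In row `k` the claim would contradict `bottomEnd`; the case is void because no row is left for
  -- the low vertex.
  coloop zero ρ e _ _ _ (r , _ , l , l' , _) _ _ =
    ⊥-elim (<⇒≱ l' (subst (_≤ r) (trans (sym (+-identityʳ ρ)) e) l))
  coloop (suc m) ρ e ρ₀≤ρ {Q} {j} sep alive (r , c , l , r<k , j≤c , vx , below) {c'} c'<n q = result
    where
    ρ<k : ρ < k
    ρ<k = subst (suc ρ ≤_) (trans (sym (+-suc ρ m)) e) (m≤m+n (suc ρ) m)
    ρ<n : ρ < n
    ρ<n = <-≤-trans ρ<k k≤n
    unmarked : ¬ Q c
    unmarked qc = <-irrefl refl (below qc)
    -- Were the low vertex in row `ρ`, it would be an unmarked vertex left of the mark `c'`. So the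
    -- vertex stays strictly below every row that still has marks.
    ρ<r : ρ < r
    ρ<r with m≤n⇒m<n∨m≡n l
    ... | inj₁ lt = lt
    ... | inj₂ refl = ⊥-elim (unmarkedNotVtx ρ<n sep alive j≤c unmarked (below q) c'<n q vx)
    ih : ∀ {d} → d < n → Marked ρ<n sep alive d → vert-flow (suc ρ) d ≡ true
    ih = coloop m (suc ρ) (trans (sym (+-suc ρ m)) e) (≤-trans ρ₀≤ρ (n≤1+n ρ))
           (separated-next ρ<n sep alive) (alive-next ρ<n sep alive)
           (r , c , ρ<r , r<k , j≤c , vx ,
            λ { (inj₁ (q , _)) → below q ; (inj₂ (_ , _ , lt , q , _)) → <-trans (below q) lt })
    notRight : IsVtx n E ρ c' → h ρ (suc c') ≡ true ⊎ vert-flow ρ c' ≡ true → vert-flow ρ c' ≡ true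
    notRight _ (inj₂ a) = a
    notRight vx' (inj₁ a) with nextRight ρ<k ρ<n c'<n a
    ... | d , lt , vxᵈ , a' , gap =
      ⊥-elim (not-both-in ρ<k vxᵈ a' (ih (proj₁ (proj₂ vxᵈ))
        (inj₂ (trans (sym (agree ρ₀≤ρ ρ<k (proj₁ (proj₂ vxᵈ)))) (proj₁ (enter ρ<k vxᵈ (inj₁ a'))) ,
               c' , lt , q , vx' ,
               λ b l l' → gap b l l' ∘ fromE ρ₀≤ρ ρ<k))))
    straight : kind (E ρ c') ≡ pass → c' ≢ u ρ → vert-flow ρ c' ≡ true
    straight t c≢u = trans (proj₂ (pass-rule ρ<k c'<n (trans (cong kind (agree ρ₀≤ρ ρ<k c'<n)) t)))
                           (ih c'<n (inj₁ (q , c≢u)))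
    result : vert-flow ρ c' ≡ true
    result with kind (E ρ c') in eq
    ... | pass = straight eq λ { refl → contradiction (trans (sym eq) (cong kind (pivotAt ρ ρ<n))) λ () }
    ... | piv  = notRight vx' (emit ρ<k c'<n (trans (agree ρ₀≤ρ ρ<k c'<n) t))
      where
      t = kind-piv _ eq
      vx' = ρ<n , c'<n , inj₁ t
    ... | elb  = notRight vx' (proj₂ (enter ρ<k (fromE ρ₀≤ρ ρ<k vx') (inj₂ (ih c'<n (inj₁ (q , c≢u))))))
      where
      vx' = ρ<n , c'<n , inj₂ (kind-elb _ eq)
      c≢u : c' ≢ u ρ
      c≢u refl = contradiction (trans (sym eq) (cong kind (pivotAt ρ ρ<n))) λ ()

  -- Start with the single mark `j'`. The pipe entering the next row there turned right before
  -- column `j`, so in row `i` it crosses every pipe coming down in the columns from `j` up to `j'`,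
  -- and by reducedness and the condition on touching it is apart from them below. In matroid terms
  -- `j'` is a coloop for the rows below `i`.
  crossing⇒coloop : ∀ {i j j'} → ρ₀ ≤ suc i → i < k → E i j ≡ cross → j < j' → j' < n → E i j' ≡ elbow →
                    (∀ d → j < d → d < j' → ¬ IsVtx n E i d) →
                    (∃ λ r → i < r × r < k × IsVtx n E r j) → vert-flow (suc i) j' ≡ true
  crossing⇒coloop {i} {j} {j'} ρ₀≤ i<k cr j<j' j'<n el gap (r , i<r , r<k , vx) =
    coloop (k ∸ suc i) (suc i) (m+[n∸m]≡n i<k) ρ₀≤ {_≡ j'} {j} sep alive
      (r , j , i<r , r<k , ≤-refl , vx , λ { refl → j<j' }) j'<n refl
    where
    i<n : i < n
    i<n = <-≤-trans i<k k≤n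
    notVtx : ∀ {d} → j ≤ d → d < j' → ¬ IsVtx n E i d
    notVtx l l' with m≤n⇒m<n∨m≡n l
    ... | inj₁ lt = gap _ lt l'
    ... | inj₂ refl = pass⇒¬vtx {W = E} (cong kind cr)
    sep : Separated (_≡ j') j (suc i)
    sep {c} l c<c' _ _ refl rx ry with fromAbove ry
    ... | inj₁ (_ , inj₁ t) = contradiction (trans (sym el) t) λ ()
    ... | inj₁ (_ , inj₂ t) = contradiction (trans (sym el) t) λ ()
    ... | inj₂ (ry' , _) with traceLeft ry' | fromAbove rx
    ...   | _ | inj₂ (_ , t) = ⊥-elim (notVtx l c<c' (i<n , <-trans c<c' j'<n , inj₂ t))
    ...   | c₀ , lt , vx₀ , _ , along , _ | inj₁ (rx' , _) =
      meet-nonvertex i<n (<-trans c<c' j'<n) rx' (along c (<-≤-trans c₀<j l) (<⇒≤ c<c')) (notVtx l c<c')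
      where
      c₀<j : c₀ < j
      c₀<j = ≰⇒> λ j≤c₀ → notVtx j≤c₀ lt vx₀
    alive : Alive (_≡ j') (suc i)
    alive _ refl = goDown i<n j'<n (proj₂ (pipeFromTop _ _ i<n j'<n (cong hasTop el)))
                     λ p → contradiction (trans (sym el) p) λ ()

-- Two adjacent rows

-- `κ` is the upper box and `κ'` the lower. The vertical edge `μ` between them is hidden because it
-- may differ between the two arrays.
Step : Kind → Kind → Bool → Bool → Bool → Bool → Bool → Bool → Set
Step κ κ' s t a b a' b' = ∃ λ μ → Rule κ' b s b' μ × Rule κ a μ a' t

-- m columns of two rows from column c on, entered with the carries a (top row)
-- and b (bottom row) and left with none; s is the input from below, t the output above.
data Run (x y : ℕ → Kind) (s t : ℕ → Bool) : ℕ → ℕ → Bool → Bool → Set where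
  done : ∀ {c} → Run x y s t 0 c false false
  _∷_  : ∀ {m c a b a' b'} → Step (x c) (y c) (s c) (t c) a b a' b' →
         Run x y s t m (suc c) a' b' → Run x y s t (suc m) c a b

Step-cong : ∀ {κ κ' λ' λ″ s t a b a' b'} → κ ≡ κ' → λ' ≡ λ″ →
        Step κ λ' s t a b a' b' → Step κ' λ″ s t a b a' b'
Step-cong refl refl st = st

carry-case : ∀ {κ s b' μ} → Rule κ true s b' μ → (κ ≡ pass × b' ≡ true) ⊎ (κ ≡ elb × s ≡ false)
carry-case thru = inj₁ (refl , refl)
carry-case →→   = inj₂ (refl , refl)
carry-case →↑   = inj₂ (refl , refl)

-- The carry cannot leave at the right end, and a pivot accepts none, so it ends at an elbow; being
-- entered from the left, that elbow has no input from below.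
carry-stops : ∀ {x y s t m c a} → Run x y s t m c a true →
              ∃ λ c' → c ≤ c' × c' < c + m × y c' ≡ elb × s c' ≡ false × (∀ d → c ≤ d → d < c' → y d ≡ pass)
carry-stops {y = y} {m = suc m} {c} ((_ , r , _) ∷ rs) with carry-case r
... | inj₂ (e , e') = c , ≤-refl , m<m+n c (s≤s z≤n) , e , e' , λ d l l' → ⊥-elim (<⇒≱ l' l)
... | inj₁ (e , refl) with carry-stops rs
...   | c' , l , l' , p , q , gap = c' , <⇒≤ l , subst (c' <_) (sym (+-suc c m)) l' , p , q , gap'
  where
  gap' : ∀ d → c ≤ d → d < c' → y d ≡ pass
  gap' d l l' with m≤n⇒m<n∨m≡n l
  ... | inj₁ lt = gap d lt l'
  ... | inj₂ refl = e

-- Sim a b a' b': the carries a, b of the top and bottom rows of one array are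
-- replaced by a', b' in the other.  A path may run in the bottom row of the first
-- while its counterpart already runs in the top row of the second.
data Sim : Bool → Bool → Bool → Bool → Set where
  same : ∀ {a b} → Sim a b a b
  slip : Sim false true true false

top-passes : ∀ {κ s t a b a' b'} → Step pass κ s t a b a' b' → a' ≡ a × Step κ pass s t b a b' a
top-passes (_ , r , thru) = refl , _ , thru , r

bottom-passes : ∀ {κ s t a b a' b'} → Step κ pass s t a b a' b' → b' ≡ b × Step pass κ s t b a b a'
bottom-passes (_ , thru , r) = refl , _ , r , thru

passes-slip : ∀ {s t a b} → Step pass pass s t false true a b →
              a ≡ false × b ≡ true × Step pass pass s t true false true false
passes-slip (_ , thru , thru) = refl , refl , _ , thru , thru

elbows-slip : ∀ {s t a b} → Step elb elb s t false true a b →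
              ∃₂ λ a' b' → Sim a b a' b' × Step elb elb s t true false a' b'
elbows-slip (_ , →→ , idle) = _ , _ , slip , _ , idle , →→
elbows-slip (_ , →↑ , ↑→)   = _ , _ , same , _ , idle , →→
elbows-slip (_ , →↑ , ↑↑)   = _ , _ , same , _ , idle , →↑

elbows-unslip : ∀ {s t a b} → Step elb elb s t a b true false →
                ∃₂ λ a' b' → Sim a' b' a b × Step elb elb s t a' b' false true
elbows-unslip (_ , idle , →→) = _ , _ , slip , _ , →→ , idle
elbows-unslip (_ , →↑ , ↑→)   = _ , _ , same , _ , →→ , idle
elbows-unslip (_ , ↑↑ , ↑→)   = _ , _ , same , _ , ↑→ , idle

-- The first alternative is the obstruction: the input passes the lower box and reaches the upper
-- elbow, which in the other array is already entered from the left.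
upper-elbow-slip : ∀ {s t a b} → Step elb pass s t false true a b →
                   (b ≡ true × s ≡ true) ⊎ (a ≡ false × b ≡ true × Step elb pass s t true false true false)
upper-elbow-slip (_ , thru , idle) = inj₂ (refl , refl , _ , thru , →→)
upper-elbow-slip (_ , thru , ↑→)   = inj₁ (refl , refl)
upper-elbow-slip (_ , thru , ↑↑)   = inj₁ (refl , refl)

upper-elbow-unslip : ∀ {s t a b} → Step elb pass s t a b true false →
                     s ≡ true ⊎ (a ≡ true × b ≡ false × Step elb pass s t false true false true)
upper-elbow-unslip (_ , thru , →→) = inj₂ (refl , refl , _ , thru , idle)
upper-elbow-unslip (_ , thru , ↑→) = inj₁ refl

passes-unslip : ∀ {s t a b} → Step pass pass s t a b true false →
                a ≡ true × b ≡ false × Step pass pass s t false true false true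
passes-unslip (_ , thru , thru) = refl , refl , _ , thru , thru

-- At j* a possible lag is settled: the added lower elbow lets the two paths of the other array turn
-- as the one elbow of the first does. The carry `b'` changes rows, as the rows trade places from
-- here on.
star-to : ∀ {s t a b p q b'} → Sim a b p q → Step pass elb s t a b false b' → Step elb elb s t p q b' false
star-to same (_ , idle , thru) = _ , idle , idle
star-to same (_ , →→ , thru)   = _ , →↑ , ↑→
star-to same (_ , →↑ , thru)   = _ , →↑ , ↑↑
star-to same (_ , ↑→ , thru)   = _ , ↑↑ , ↑→
star-to same (_ , ↑↑ , thru)   = _ , ↑↑ , ↑↑
star-to slip (_ , →→ , thru)   = _ , idle , →→
star-to slip (_ , →↑ , thru)   = _ , idle , →↑

star-from : ∀ {s t p q b'} → Step elb elb s t p q b' false →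
            ∃₂ λ a b → Sim a b p q × Step pass elb s t a b false b'
star-from (_ , idle , idle) = _ , _ , same , _ , idle , thru
star-from (_ , idle , →→)   = _ , _ , slip , _ , →→ , thru
star-from (_ , idle , →↑)   = _ , _ , slip , _ , →↑ , thru
star-from (_ , →↑ , ↑→)     = _ , _ , same , _ , →→ , thru
star-from (_ , →↑ , ↑↑)     = _ , _ , same , _ , →↑ , thru
star-from (_ , ↑↑ , ↑→)     = _ , _ , same , _ , ↑→ , thru
star-from (_ , ↑↑ , ↑↑)     = _ , _ , same , _ , ↑↑ , thru

-- The origin of `slip`: if the lower source sends its path to the right and the elbow above it is
-- idle, the moved source sends its path along the upper row.
turn-to : ∀ {s t a a' b'} → Step elb piv s t a false a' b' →
          ∃₂ λ p q → Sim a' b' p q × Step piv pass s t false a p q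
turn-to (_ , source→ , idle) = _ , _ , slip , _ , thru , source→
turn-to (_ , source→ , →→)   = _ , _ , same , _ , thru , source→
turn-to (_ , source→ , →↑)   = _ , _ , same , _ , thru , source↑
turn-to (_ , source↑ , ↑→)   = _ , _ , same , _ , thru , source→
turn-to (_ , source↑ , ↑↑)   = _ , _ , same , _ , thru , source↑

turn-from : ∀ {s t a p q a' b'} → Sim a' b' p q → Step piv pass s t false a p q → Step elb piv s t a false a' b'
turn-from {a = true}  same (_ , thru , source→) = _ , source→ , →→
turn-from {a = false} same (_ , thru , source→) = _ , source↑ , ↑→
turn-from {a = true}  same (_ , thru , source↑) = _ , source→ , →↑
turn-from {a = false} same (_ , thru , source↑) = _ , source↑ , ↑↑
turn-from slip (_ , thru , source→) = _ , source→ , idle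

-- Rows x, y of one array and x', y' of the other, each given by the kinds of its boxes.
module TwoRows (x y x' y' : ℕ → Kind) (s t : ℕ → Bool) (n : ℕ) where

  -- Excludes that a path coming from below crosses a path carried in row y.
  Forcing : ℕ → Set
  Forcing c = s c ≡ true → ∀ c' → c < c' → c' < n → y c' ≡ elb →
              (∀ d → c < d → d < c' → y d ≡ pass) → s c' ≡ true

  -- `pass` above `elb` is missing, since the first such column is j* and is treated by `star`.
  data Shape (c : ℕ) : Set where
    pass-pass : x c ≡ pass → y c ≡ pass → Shape c
    elb-pass  : x c ≡ elb  → y c ≡ pass → Forcing c → Shape c
    elb-elb   : x c ≡ elb  → y c ≡ elb  → Shape c

  -- Early, Middle and Late describe the m columns from c on, for c at most the pivot
  -- of the lower row, between that pivot and j*, and beyond j*, respectively.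
  data Late : ℕ → ℕ → Set where
    end  : ∀ {c} → Late 0 c
    swap : ∀ {m c} → x c ≡ pass → y' c ≡ pass → x' c ≡ y c → Late m (suc c) → Late (suc m) c

  data Middle : ℕ → ℕ → Set where
    end  : ∀ {c} → Middle 0 c
    keep : ∀ {m c} → x' c ≡ x c → y' c ≡ y c → Shape c → Middle m (suc c) → Middle (suc m) c
    star : ∀ {m c} → x c ≡ pass → y c ≡ elb → x' c ≡ elb → y' c ≡ elb → Late m (suc c) → Middle (suc m) c

  data Early : ℕ → ℕ → Set where
    swap : ∀ {m c} → y c ≡ pass → x' c ≡ pass → y' c ≡ x c → Early m (suc c) → Early (suc m) c
    turn : ∀ {m c} → x c ≡ elb → y c ≡ piv → x' c ≡ piv → y' c ≡ pass → Middle m (suc c) → Early (suc m) c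
    turnStar : ∀ {m c} → x c ≡ pass → y c ≡ piv → x' c ≡ piv → y' c ≡ pass → Late m (suc c) → Early (suc m) c

  Run₁ Run₂ : ℕ → ℕ → Bool → Bool → Set
  Run₁  = Run x y s t
  Run₂ = Run x' y' s t

  late-to : ∀ {m c b} → Late m c → Run₁ m c false b → Run₂ m c b false
  late-to end done = done
  late-to (swap e e' e″ l) (st ∷ rs) with top-passes (Step-cong e refl st)
  ... | refl , st' = Step-cong (sym e″) (sym e') st' ∷ late-to l rs

  late-from : ∀ {m c b} → Late m c → Run₂ m c b false → Run₁ m c false b
  late-from end done = done
  late-from (swap e e' e″ l) (st ∷ rs) with bottom-passes (Step-cong e″ e' st)
  ... | refl , st' = Step-cong (sym e) refl st' ∷ late-from l rs

  -- Beyond j* the upper row has only `pass` boxes, so a carry in it would leave the array on the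
  -- right.
  late-top-dead : ∀ {m c b} → Late m c → ¬ Run₁ m c true b
  late-top-dead (swap e _ _ l) (st ∷ rs) with top-passes (Step-cong e refl st)
  ... | refl , _ = late-top-dead l rs

  late-bottom-dead : ∀ {m c a} → Late m c → ¬ Run₂ m c a true
  late-bottom-dead (swap _ e' _ l) (st ∷ rs) with bottom-passes (Step-cong refl e' st)
  ... | refl , _ = late-bottom-dead l rs

  -- The lower carry ends at an elbow without input from below, while `Forcing` demands that very
  -- input.
  no-crossing : ∀ {m c a} → suc c + m ≡ n → Forcing c → s c ≡ true → ¬ Run₁ m (suc c) a true
  no-crossing e force sc rs with carry-stops rs
  ... | c' , l , l' , p , q , gap = contradiction (trans (sym q) (force sc c' l (subst (c' <_) e l') p gap)) λ ()

  shift : ∀ {m c} → c + suc m ≡ n → suc c + m ≡ n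
  shift {m} {c} = trans (sym (+-suc c m))

  middle-to : ∀ {m c a b p q} → c + m ≡ n → Middle m c → Sim a b p q → Run₁ m c a b → Run₂ m c p q
  middle-to _ end same done = done
  middle-to i (keep e e' _ M) same (st ∷ rs) = Step-cong (sym e) (sym e') st ∷ middle-to (shift i) M same rs
  middle-to i (keep e e' (pass-pass f f') M) slip (st ∷ rs) with passes-slip (Step-cong f f' st)
  ... | refl , refl , st' = Step-cong (sym (trans e f)) (sym (trans e' f')) st' ∷ middle-to (shift i) M slip rs
  middle-to i (keep e e' (elb-elb f f') M) slip (st ∷ rs) with elbows-slip (Step-cong f f' st)
  ... | _ , _ , sim , st' = Step-cong (sym (trans e f)) (sym (trans e' f')) st' ∷ middle-to (shift i) M sim rs
  middle-to i (keep e e' (elb-pass f f' force) M) slip (st ∷ rs) with upper-elbow-slip (Step-cong f f' st)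
  ... | inj₁ (refl , sc) = ⊥-elim (no-crossing (shift i) force sc rs)
  ... | inj₂ (refl , refl , st') = Step-cong (sym (trans e f)) (sym (trans e' f')) st' ∷ middle-to (shift i) M slip rs
  middle-to i (star e f e' f' L) sim (_∷_ {a' = true} st rs)  = ⊥-elim (late-top-dead L rs)
  middle-to i (star e f e' f' L) sim (_∷_ {a' = false} st rs) =
    Step-cong (sym e') (sym f') (star-to sim (Step-cong e f st)) ∷ late-to L rs

  -- Built from the right: whether a carry in the upper row of the second array stems from the upper
  -- or the lower row of the first is decided only by later columns.
  middle-from : ∀ {m c p q} → c + m ≡ n → Middle m c → Run₂ m c p q →
                ∃₂ λ a b → Sim a b p q × Run₁ m c a b
  middle-from _ end done = _ , _ , same , done
  middle-from i (keep e e' sh M) (st ∷ rs) with middle-from (shift i) M rs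
  ... | _ , _ , same , rs' = _ , _ , same , Step-cong e e' st ∷ rs'
  ... | _ , _ , slip , rs' with sh
  ...   | pass-pass f f' with passes-unslip (Step-cong (trans e f) (trans e' f') st)
  ...     | refl , refl , st' = _ , _ , slip , Step-cong (sym f) (sym f') st' ∷ rs'
  middle-from i (keep e e' sh M) (st ∷ rs) | _ , _ , slip , rs' | elb-elb f f'
    with elbows-unslip (Step-cong (trans e f) (trans e' f') st)
  ...     | _ , _ , sim , st' = _ , _ , sim , Step-cong (sym f) (sym f') st' ∷ rs'
  middle-from i (keep e e' sh M) (st ∷ rs) | _ , _ , slip , rs' | elb-pass f f' force
    with upper-elbow-unslip (Step-cong (trans e f) (trans e' f') st)
  ...     | inj₁ sc = ⊥-elim (no-crossing (shift i) force sc rs')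
  ...     | inj₂ (refl , refl , st') = _ , _ , slip , Step-cong (sym f) (sym f') st' ∷ rs'
  middle-from i (star e f e' f' L) (_∷_ {b' = true} st rs) = ⊥-elim (late-bottom-dead L rs)
  middle-from i (star e f e' f' L) (_∷_ {b' = false} st rs) with star-from (Step-cong e' f' st)
  ... | _ , _ , sim , st' = _ , _ , sim , Step-cong (sym e) (sym f) st' ∷ late-from L rs

  -- Before its pivot the lower row has only `pass` boxes and carries nothing, so up to there the
  -- rows merely trade places.
  early-to : ∀ {m c a} → c + m ≡ n → Early m c → Run₁ m c a false → Run₂ m c false a
  early-to i (swap e e' e″ M) (st ∷ rs) with bottom-passes (Step-cong refl e st)
  ... | refl , st' = Step-cong (sym e') (sym e″) st' ∷ early-to (shift i) M rs
  early-to i (turn e f e' f' M) (st ∷ rs) with turn-to (Step-cong e f st)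
  ... | _ , _ , sim , st' = Step-cong (sym e') (sym f') st' ∷ middle-to (shift i) M sim rs
  early-to i (turnStar e f e' f' L) (st ∷ rs) with top-passes (Step-cong e f st)
  early-to {a = true}  i (turnStar e f e' f' L) (st ∷ rs) | refl , st' = ⊥-elim (late-top-dead L rs)
  early-to {a = false} i (turnStar e f e' f' L) (st ∷ rs) | refl , st' =
    Step-cong (sym e') (sym f') st' ∷ late-to L rs

  early-from : ∀ {m c a} → c + m ≡ n → Early m c → Run₂ m c false a → Run₁ m c a false
  early-from i (swap e e' e″ M) (st ∷ rs) with top-passes (Step-cong e' e″ st)
  ... | refl , st' = Step-cong refl (sym e) st' ∷ early-from (shift i) M rs
  early-from i (turn e f e' f' M) (st ∷ rs) with middle-from (shift i) M rs
  ... | _ , _ , sim , rs' = Step-cong (sym e) (sym f) (turn-from sim (Step-cong e' f' st)) ∷ rs'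
  early-from i (turnStar e f e' f' L) (st ∷ rs) with bottom-passes (Step-cong e' f' st)
  early-from {a = true}  i (turnStar e f e' f' L) (st ∷ rs) | refl , st' = ⊥-elim (late-bottom-dead L rs)
  early-from {a = false} i (turnStar e f e' f' L) (st ∷ rs) | refl , st' =
    Step-cong (sym e) (sym f) st' ∷ late-from L rs

-- Replacing two adjacent rows of a flow

rule-cong : ∀ {κ κ' a a' b b' c c' d d'} → κ ≡ κ' → a ≡ a' → b ≡ b' → c ≡ c' → d ≡ d' →
            Rule κ a b c d → Rule κ' a' b' c' d'
rule-cong refl refl refl refl refl r = r

module _ {x y : ℕ → Kind} {s t : ℕ → Bool} where

  tops bottoms middles : ∀ {m c a b} → Run x y s t m c a b → ℕ → Bool
  tops done _ = false
  tops (_∷_ {a = a} _ _) zero = a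
  tops (_ ∷ rs) (suc d) = tops rs d
  bottoms done _ = false
  bottoms (_∷_ {b = b} _ _) zero = b
  bottoms (_ ∷ rs) (suc d) = bottoms rs d
  middles done _ = false
  middles ((μ , _) ∷ _) zero = μ
  middles (_ ∷ rs) (suc d) = middles rs d

  tops-start : ∀ {m c a b} (rs : Run x y s t m c a b) → tops rs 0 ≡ a
  tops-start done    = refl
  tops-start (_ ∷ _) = refl

  bottoms-start : ∀ {m c a b} (rs : Run x y s t m c a b) → bottoms rs 0 ≡ b
  bottoms-start done    = refl
  bottoms-start (_ ∷ _) = refl

  tops-end : ∀ {m c a b} (rs : Run x y s t m c a b) → tops rs m ≡ false
  tops-end done     = refl
  tops-end (_ ∷ rs) = tops-end rs

  bottoms-end : ∀ {m c a b} (rs : Run x y s t m c a b) → bottoms rs m ≡ false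
  bottoms-end done     = refl
  bottoms-end (_ ∷ rs) = bottoms-end rs

  run-rules : ∀ {m c a b} (rs : Run x y s t m c a b) d → d < m →
              Rule (y (c + d)) (bottoms rs d) (s (c + d)) (bottoms rs (suc d)) (middles rs d) ×
              Rule (x (c + d)) (tops rs d) (middles rs d) (tops rs (suc d)) (t (c + d))
  run-rules {c = c} (_∷_ {a' = a'} {b'} (_ , r , r') rs) zero _
    rewrite +-identityʳ c | tops-start rs | bottoms-start rs = r , r'
  run-rules {c = c} (_ ∷ rs) (suc d) (s≤s l) rewrite +-suc c d = run-rules rs d l

flow⇒run : ∀ {n k W J} (F : Flow n k W J) {i} → suc i < k → ∀ m c → c + m ≡ n →
           Run (kind ∘ W i) (kind ∘ W (suc i)) (Flow.v F (suc (suc i))) (Flow.v F i) m c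
               (Flow.h F i c) (Flow.h F (suc i) c)
flow⇒run F {i} i<k zero c e with trans (sym (+-identityʳ c)) e
... | refl rewrite Flow.rightEnd F (<⇒≤ i<k) | Flow.rightEnd F i<k = done
flow⇒run {n} F {i} i<k (suc m) c e =
  (Flow.v F (suc i) c , Flow.rule F i<k c<n , Flow.rule F (<⇒≤ i<k) c<n) ∷
  flow⇒run F i<k m (suc c) (trans (sym (+-suc c m)) e)
  where
  c<n : c < n
  c<n = subst (c <_) e (m<m+n c (s≤s z≤n))

override : ∀ {A : Set} → ℕ → A → (ℕ → A) → ℕ → A
override r x f r' with r' ≟ r
... | yes _ = x
... | no _  = f r'

override-≡ : ∀ {A : Set} r (x : A) f → override r x f r ≡ x
override-≡ r x f with r ≟ r
... | yes _ = refl
... | no ne = ⊥-elim (ne refl)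

override-≢ : ∀ {A : Set} r (x : A) f {r'} → r' ≢ r → override r x f r' ≡ f r'
override-≢ r x f {r'} ne with r' ≟ r
... | yes e = ⊥-elim (ne e)
... | no _  = refl

module ReplaceRows {n k : ℕ} {W W' : Grid} {J : Subset n} (F : Flow n k W J) {i : ℕ} (i<k : suc i < k)
                   (others : ∀ {r j} → r ≢ i → r ≢ suc i → W' r j ≡ W r j)
                   (rs : Run (kind ∘ W' i) (kind ∘ W' (suc i)) (Flow.v F (suc (suc i))) (Flow.v F i) n 0 false false)
                   where
  open Flow F

  -- A run keeps the vertical edges below and above the two rows, so the only vertical level to
  -- change is `suc i`, between them.
  h' v' : ℕ → ℕ → Bool
  h' = override i (tops rs) (override (suc i) (bottoms rs) h)
  v' = override (suc i) (middles rs) v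

  apply-≡ : ∀ {f g : ℕ → Bool} j → f ≡ g → g j ≡ f j
  apply-≡ j refl = refl

  h'-top : h' i ≡ tops rs
  h'-top = override-≡ i _ _

  h'-bottom : h' (suc i) ≡ bottoms rs
  h'-bottom = trans (override-≢ i _ _ 1+n≢n) (override-≡ (suc i) _ _)

  h'-other : ∀ {r} → r ≢ i → r ≢ suc i → h' r ≡ h r
  h'-other p q = trans (override-≢ i _ _ p) (override-≢ (suc i) _ _ q)

  v'-middle : v' (suc i) ≡ middles rs
  v'-middle = override-≡ (suc i) _ _

  v'-other : ∀ {r} → r ≢ suc i → v' r ≡ v r
  v'-other = override-≢ (suc i) _ _

  replaced : Flow n k W' J
  replaced = record
    { h = h' ; v = v'
    ; leftEnd   = λ {r} l → ends 0 (tops-start rs) (bottoms-start rs) r (leftEnd l)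
    ; rightEnd  = λ {r} l → ends n (tops-end rs) (bottoms-end rs) r (rightEnd l)
    ; bottomEnd = λ {j} l → trans (cong (λ f → f j) (v'-other (>⇒≢ i<k))) (bottomEnd l)
    ; topEnd    = λ j → trans (cong (λ f → f (toℕ j)) (v'-other {0} λ ())) (topEnd j)
    ; rule      = rule'
    }
    where
    ends : ∀ j → tops rs j ≡ false → bottoms rs j ≡ false → ∀ r → h r j ≡ false → h' r j ≡ false
    ends j p q r e = go (r ≟ i) (r ≟ suc i)
      where
      go : Dec (r ≡ i) → Dec (r ≡ suc i) → h' r j ≡ false
      go (yes refl) _        = trans (cong (λ f → f j) h'-top) p
      go (no _) (yes refl)   = trans (cong (λ f → f j) h'-bottom) q
      go (no ne) (no ne')    = trans (cong (λ f → f j) (h'-other ne ne')) e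
    rule' : ∀ {r j} → r < k → j < n → Rule (kind (W' r j)) (h' r j) (v' (suc r) j) (h' r (suc j)) (v' r j)
    rule' {r} {j} l l' = go (r ≟ i) (r ≟ suc i)
      where
      go : Dec (r ≡ i) → Dec (r ≡ suc i) → Rule (kind (W' r j)) (h' r j) (v' (suc r) j) (h' r (suc j)) (v' r j)
      go (yes refl) _ = rule-cong refl (apply-≡ j h'-top) (apply-≡ j v'-middle) (apply-≡ (suc j) h'-top)
                          (apply-≡ j (v'-other (<⇒≢ ≤-refl))) (proj₂ (run-rules rs j l'))
      go (no _) (yes refl) = rule-cong refl (apply-≡ j h'-bottom) (apply-≡ j (v'-other 1+n≢n))
                               (apply-≡ (suc j) h'-bottom) (apply-≡ j v'-middle) (proj₁ (run-rules rs j l'))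
      go (no p) (no q) = rule-cong (cong kind (sym (others p q))) (apply-≡ j (h'-other p q))
                           (apply-≡ j (v'-other (p ∘ suc-injective))) (apply-≡ (suc j) (h'-other p q))
                           (apply-≡ j (v'-other q)) (rule l l')

-- The tiles of a standardized array

T⇒true : ∀ {b} → T b → b ≡ true
T⇒true = Equivalence.to T-≡

¬T⇒false : ∀ {b} → ¬ T b → b ≡ false
¬T⇒false {true}  nt = ⊥-elim (nt tt)
¬T⇒false {false} _  = refl

≡ᵇ-true : ∀ {m o} → m ≡ o → (m ≡ᵇ o) ≡ true
≡ᵇ-true {m} {o} = T⇒true ∘ ≡⇒≡ᵇ m o

≡ᵇ-false : ∀ {m o} → m ≢ o → (m ≡ᵇ o) ≡ false
≡ᵇ-false {m} {o} ne = ¬T⇒false (ne ∘ ≡ᵇ⇒≡ m o)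

≤ᵇ-true : ∀ {m o} → m ≤ o → (m ≤ᵇ o) ≡ true
≤ᵇ-true = T⇒true ∘ ≤⇒≤ᵇ

≤ᵇ-false : ∀ {m o} → o < m → (m ≤ᵇ o) ≡ false
≤ᵇ-false {m} {o} lt = ¬T⇒false (<⇒≱ lt ∘ ≤ᵇ⇒≤ m o)

<ᵇ-true : ∀ {m o} → m < o → (m <ᵇ o) ≡ true
<ᵇ-true = T⇒true ∘ <⇒<ᵇ

<ᵇ-false : ∀ {m o} → o ≤ m → (m <ᵇ o) ≡ false
<ᵇ-false {m} {o} le = ¬T⇒false (≤⇒≯ le ∘ <ᵇ⇒< m o)

module _ (D : Grid) (i : ℕ) where

  CrossOverVtx : ℕ → Set
  CrossOverVtx c = D i c ≡ cross × (D (suc i) c ≡ pivot ⊎ D (suc i) c ≡ elbow)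

  crossOverVtx⇒ : ∀ {c} → (isCrossB (D i c) ∧ isElbowOrPivotB (D (suc i) c)) ≡ true → CrossOverVtx c
  crossOverVtx⇒ {c} e with D i c | D (suc i) c
  ... | cross | pivot = refl , inj₁ refl
  ... | cross | elbow = refl , inj₂ refl

  ⇒crossOverVtx : ∀ {c} → CrossOverVtx c → (isCrossB (D i c) ∧ isElbowOrPivotB (D (suc i) c)) ≡ true
  ⇒crossOverVtx (e , inj₁ e') rewrite e | e' = refl
  ⇒crossOverVtx (e , inj₂ e') rewrite e | e' = refl

  data Search (j r : ℕ) : Maybe ℕ → Set where
    found  : ∀ {s} → j ≤ s → s < j + r → CrossOverVtx s → (∀ c → j ≤ c → c < s → ¬ CrossOverVtx c) →
             Search j r (just s)
    absent : (∀ c → j ≤ c → c < j + r → ¬ CrossOverVtx c) → Search j r nothing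

  search : ∀ j r → Search j r (searchJ D i j r)
  search j zero = absent λ c l l' → ⊥-elim (<⇒≱ l' (subst (_≤ c) (sym (+-identityʳ j)) l))
  search j (suc r) with isCrossB (D i j) ∧ isElbowOrPivotB (D (suc i) j) in eq
  ... | true = found ≤-refl (m<m+n j (s≤s z≤n)) (crossOverVtx⇒ eq) λ c l l' → ⊥-elim (<⇒≱ l' l)
  ... | false with searchJ D i (suc j) r | search (suc j) r
  ...   | .(just _) | found {s} l l' x gap = found (<⇒≤ l) (subst (s <_) (sym (+-suc j r)) l') x gap'
    where
    gap' : ∀ c → j ≤ c → c < s → ¬ CrossOverVtx c
    gap' c p p' y with m≤n⇒m<n∨m≡n p
    ... | inj₁ lt = gap c lt p' y
    ... | inj₂ refl = contradiction (trans (sym eq) (⇒crossOverVtx y)) λ ()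
  ...   | .nothing | absent gap = absent gap'
    where
    gap' : ∀ c → j ≤ c → c < j + suc r → ¬ CrossOverVtx c
    gap' c p p' y with m≤n⇒m<n∨m≡n p
    ... | inj₁ lt = gap c lt (subst (c <_) (+-suc j r) p') y
    ... | inj₂ refl = contradiction (trans (sym eq) (⇒crossOverVtx y)) λ ()

module StTiles (n : ℕ) (u : ℕ → ℕ) (i : ℕ) (D : Grid) where

  swapped starred : Maybe ℕ → ℕ → Bool
  swapped js c = (c ≤ᵇ u (suc i)) ∨ maybe′ (λ s → s ≤ᵇ c) false js
  starred js c = maybe′ (λ s → (u (suc i) <ᵇ s) ∧ (c ≡ᵇ s)) false js

  st-other : ∀ {r c} → r ≢ i → r ≢ suc i → st n u i D r c ≡ D r c
  st-other {r} {c} p q rewrite ≡ᵇ-false p | ≡ᵇ-false q = refl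

  -- The value `js` of j* comes with an equation, so that later splits on it leave the search
  -- folded.
  st-top : ∀ {c js} → jStar n u i D ≡ js →
           st n u i D i c ≡ (if c ≡ᵇ u i then vert else if swapped js c then D (suc i) c else D i c)
  st-top refl rewrite ≡ᵇ-true {i} refl | ≡ᵇ-false {i} {suc i} (<⇒≢ ≤-refl) = refl

  st-bottom : ∀ {c js} → jStar n u i D ≡ js →
              st n u i D (suc i) c ≡ (if c ≡ᵇ u (suc i) then horiz else if starred js c then elbow
                                      else if swapped js c then D i c else D (suc i) c)
  st-bottom refl rewrite ≡ᵇ-true {i} refl | ≡ᵇ-false {suc i} {i} 1+n≢n = refl

  swapped-≤ : ∀ {js c} → c ≤ u (suc i) → swapped js c ≡ true
  swapped-≤ l rewrite ≤ᵇ-true l = refl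

  swapped-≥ : ∀ {s c} → s ≤ c → swapped (just s) c ≡ true
  swapped-≥ {s} {c} l rewrite ≤ᵇ-true l = ∨-zeroʳ (c ≤ᵇ u (suc i))

  Before : Maybe ℕ → ℕ → Set
  Before js c = maybe′ (λ s → c < s) ⊤ js

  swapped-between : ∀ {js c} → u (suc i) < c → Before js c → swapped js c ≡ false
  swapped-between {nothing} l _ rewrite ≤ᵇ-false l = refl
  swapped-between {just s} l l' rewrite ≤ᵇ-false l = ≤ᵇ-false l'

  starred-false : ∀ {js c} → (∀ {s} → js ≡ just s → u (suc i) < s → c ≢ s) → starred js c ≡ false
  starred-false {nothing} _ = refl
  starred-false {just s} ne with u (suc i) <ᵇ s in eq
  ... | false = refl
  ... | true  = ≡ᵇ-false (ne refl (<ᵇ⇒< (u (suc i)) s (Equivalence.from T-≡ eq)))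

  starred-true : ∀ {s} → u (suc i) < s → starred (just s) s ≡ true
  starred-true {s} l rewrite <ᵇ-true l = ≡ᵇ-true {s} refl

  if-true : ∀ {A : Set} {p : Bool} {x y : A} → p ≡ true → (if p then x else y) ≡ x
  if-true refl = refl

  if-false : ∀ {A : Set} {p : Bool} {x y : A} → p ≡ false → (if p then x else y) ≡ y
  if-false refl = refl

  module _ {js : Maybe ℕ} {c : ℕ} (e : jStar n u i D ≡ js) where

    top-pivot : c ≡ u i → st n u i D i c ≡ vert
    top-pivot p = trans (st-top e) (if-true (≡ᵇ-true p))

    top-swapped : c ≢ u i → swapped js c ≡ true → st n u i D i c ≡ D (suc i) c
    top-swapped ne sw = trans (st-top e) (trans (if-false (≡ᵇ-false ne)) (if-true sw))

    top-kept : c ≢ u i → swapped js c ≡ false → st n u i D i c ≡ D i c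
    top-kept ne sw = trans (st-top e) (trans (if-false (≡ᵇ-false ne)) (if-false sw))

    bottom-pivot : c ≡ u (suc i) → st n u i D (suc i) c ≡ horiz
    bottom-pivot p = trans (st-bottom e) (if-true (≡ᵇ-true p))

    bottom-starred : c ≢ u (suc i) → starred js c ≡ true → st n u i D (suc i) c ≡ elbow
    bottom-starred ne sr = trans (st-bottom e) (trans (if-false (≡ᵇ-false ne)) (if-true sr))

    bottom-swapped : c ≢ u (suc i) → starred js c ≡ false → swapped js c ≡ true → st n u i D (suc i) c ≡ D i c
    bottom-swapped ne sr sw =
      trans (st-bottom e) (trans (if-false (≡ᵇ-false ne)) (trans (if-false sr) (if-true sw)))

    bottom-kept : c ≢ u (suc i) → starred js c ≡ false → swapped js c ≡ false →
                  st n u i D (suc i) c ≡ D (suc i) c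
    bottom-kept ne sr sw =
      trans (st-bottom e) (trans (if-false (≡ᵇ-false ne)) (trans (if-false sr) (if-false sw)))

-- Standardization

restrict-inside : ∀ {n k} E {i j} → i < k → j < n → restrict n k E i j ≡ E i j
restrict-inside E l l' rewrite <ᵇ-true l | <ᵇ-true l' = refl

restrict-outside : ∀ {n k} E {i j} → k ≤ i → restrict n k E i j ≡ empty
restrict-outside E l rewrite <ᵇ-false l = refl

vtx-transport : ∀ {n W W' i i' j} → W' i' j ≡ W i j → i < n → IsVtx n W' i' j → IsVtx n W i j
vtx-transport e i<n (_ , j<n , t) = i<n , j<n , subst (λ t → t ≡ pivot ⊎ t ≡ elbow) e t

module Partial {n k : ℕ} {u v : ℕ → ℕ} {E D : Grid} (k≤n : k ≤ n) (fpp : IsFPP n E u v)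
               (agree : ∀ i j → D i j ≡ restrict n k E i j) where
  open Pipes fpp

  D≡E : ∀ {i j} → i < k → j < n → D i j ≡ E i j
  D≡E l l' = trans (agree _ _) (restrict-inside {n} {k} E l l')

  inside : ∀ {i j} → IsVtx n D i j → i < k
  inside {i} {j} (_ , _ , t) with i <? k
  ... | yes l = l
  ... | no nl with trans (agree i j) (restrict-outside {n} E (≮⇒≥ nl)) | t
  ...   | e | inj₁ e' = contradiction (trans (sym e) e') λ ()
  ...   | e | inj₂ e' = contradiction (trans (sym e) e') λ ()

  vtxE : ∀ {i j} → i < k → IsVtx n D i j → IsVtx n E i j
  vtxE {i} {j} l vx@(l₁ , l₂ , _) = vtx-transport {W = E} {W' = D} {i} {i} {j} (D≡E l l₂) l₁ vx

  vtxD : ∀ {i j} → i < k → IsVtx n E i j → IsVtx n D i j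
  vtxD {i} {j} l vx@(l₁ , l₂ , _) = vtx-transport {W = D} {W' = E} {i} {i} {j} (sym (D≡E l l₂)) l₁ vx

  u-injective : ∀ {i i'} → i < n → i' < n → u i ≡ u i' → i ≡ i'
  u-injective = proj₂ permutation _ _

  -- Below its pivot a column holds only empty boxes and horizontal pipes.
  noVtxBelowPivot : ∀ {i i'} → i < n → i < i' → ¬ IsVtx n E i' (u i)
  noVtxBelowPivot i<n i<i' (i'<n , l , t) with cell i'<n l | t
  ... | atPivot e _        | _ = <⇒≢ i<i' (u-injective i<n i'<n e)
  ... | vertLeft (_ , l' , l″ , e) _ _   | _ = <⇒≢ (<-trans i<i' l') (u-injective i<n l″ (sym e))
  ... | crossRight (_ , l' , l″ , e) _ _ | _ = <⇒≢ (<-trans i<i' l') (u-injective i<n l″ (sym e))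
  ... | elbowRight (_ , l' , l″ , e) _ _ | _ = <⇒≢ (<-trans i<i' l') (u-injective i<n l″ (sym e))
  ... | emptyLeft _ _ e    | inj₁ e' = contradiction (trans (sym e) e') λ ()
  ... | emptyLeft _ _ e    | inj₂ e' = contradiction (trans (sym e) e') λ ()
  ... | horizRight _ _ e   | inj₁ e' = contradiction (trans (sym e) e') λ ()
  ... | horizRight _ _ e   | inj₂ e' = contradiction (trans (sym e) e') λ ()

  network : Network n k D u
  network = record
    { k≤n       = k≤n
    ; inside    = inside
    ; column<   = λ l → proj₁ permutation _ (<-≤-trans l k≤n)
    ; pivotAt   = λ l → trans (D≡E l (proj₁ permutation _ (<-≤-trans l k≤n))) (pivotAt _ (<-≤-trans l k≤n))
    ; pivot⇒w   = λ l l' e → pivot⇒u (<-≤-trans l k≤n) l' (trans (sym (D≡E l l')) e)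
    ; noneLeft  = λ vx → vtx⇒right (vtxE (inside vx) vx)
    ; noneBelow = λ l l' vx → noVtxBelowPivot (<-≤-trans l k≤n) l' (vtxE (inside vx) vx)
    }

  module Exchange {i : ℕ} (i<k : suc i < k) (a<b : u i < u (suc i)) where
    open StTiles n u i D
    private
      a = u i
      b = u (suc i)
      D' = st n u i D
    module N = Network network

    i<k' : i < k
    i<k' = <⇒≤ i<k

    b<n : b < n
    b<n = N.column< i<k

    a<n : a < n
    a<n = N.column< i<k'

    i<n : suc i < n
    i<n = <-≤-trans i<k k≤n

    -- If j* equals `b`, then no column is `star`: column `b` is `atB`, and everything to its right
    -- is `after`.
    data Column (c : ℕ) : Set where
      before : c < b → c ≢ a → D' i c ≡ D (suc i) c → D' (suc i) c ≡ D i c → Column c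
      atA    : c ≡ a → D' i c ≡ vert → D' (suc i) c ≡ D i c → Column c
      atB    : c ≡ b → D' i c ≡ D (suc i) c → D' (suc i) c ≡ horiz → Column c
      kept   : b < c → D' i c ≡ D i c → D' (suc i) c ≡ D (suc i) c → Column c
      star   : b < c → CrossOverVtx D i c → D' i c ≡ D (suc i) c → D' (suc i) c ≡ elbow → Column c
      after  : b < c → D' i c ≡ D (suc i) c → D' (suc i) c ≡ D i c → Column c

    c>b⇒c≢a : ∀ {c} → b < c → c ≢ a
    c>b⇒c≢a l refl = <-asym l a<b

    module Eqs {js : Maybe ℕ} (e : jStar n u i D ≡ js) where

      searched : Search D i b (n ∸ b) js
      searched = subst (Search D i b (n ∸ b)) e (search D i b (n ∸ b))

      before-cov : ∀ {c} → b ≤ c → c < n → Before js c → ¬ CrossOverVtx D i c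
      before-cov {c} l l' = go searched (subst (c <_) (sym (m+[n∸m]≡n (<⇒≤ b<n))) l')
        where
        go : ∀ {r js} → Search D i b r js → c < b + r → Before js c → ¬ CrossOverVtx D i c
        go (found _ _ _ gap) _ bf = gap c l bf
        go (absent gap) lt _      = gap c l lt

      not-starred : ∀ {c} → c ≤ b → starred js c ≡ false
      not-starred l = starred-false {js} λ _ l' → <⇒≢ (≤-<-trans l l')

      keptTop : ∀ {c} → b < c → Before js c → D' i c ≡ D i c
      keptTop {c} l bf = top-kept e (c>b⇒c≢a l) (swapped-between {js} l bf)

      before⇒unstarred : ∀ {js c} → Before js c → starred js c ≡ false
      before⇒unstarred {nothing} _ = refl
      before⇒unstarred {just s} bf = starred-false {just s} λ { refl _ → <⇒≢ bf }

      keptBottom : ∀ {c} → b < c → Before js c → D' (suc i) c ≡ D (suc i) c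
      keptBottom {c} l bf = bottom-kept e (>⇒≢ l) (before⇒unstarred {js} bf) (swapped-between {js} l bf)

    module EqsJust {s : ℕ} (e : jStar n u i D ≡ just s) where
      open Eqs e public

      private
        hit : ∀ {r} → Search D i b r (just s) → b ≤ s × s < b + r × CrossOverVtx D i s
        hit (found l l' x _) = l , l' , x

      b≤star : b ≤ s
      b≤star = proj₁ (hit searched)

      star<n : s < n
      star<n = subst (s <_) (m+[n∸m]≡n (<⇒≤ b<n)) (proj₁ (proj₂ (hit searched)))

      star-cov : CrossOverVtx D i s
      star-cov = proj₂ (proj₂ (hit searched))

      afterTop : ∀ {c} → s ≤ c → c ≢ a → D' i c ≡ D (suc i) c
      afterTop l ne = top-swapped e ne (swapped-≥ l)

      afterBottom : ∀ {c} → s < c → D' (suc i) c ≡ D i c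
      afterBottom l = bottom-swapped e (>⇒≢ (≤-<-trans (b≤star) l))
                        (starred-false {just s} λ { refl _ → >⇒≢ l }) (swapped-≥ (<⇒≤ l))

      starBottom : b < s → D' (suc i) s ≡ elbow
      starBottom l = bottom-starred e (>⇒≢ l) (starred-true l)

    classify : ∀ c → Column c
    classify c with <-cmp c b
    ... | tri≈ _ refl _ = atB refl (top-swapped refl (>⇒≢ a<b) (swapped-≤ {jStar n u i D} ≤-refl))
                             (bottom-pivot refl refl)
    ... | tri< l _ _ with c ≟ a
    ...   | yes refl = atA refl (top-pivot refl refl)
                         (bottom-swapped refl (<⇒≢ l) (Eqs.not-starred refl (<⇒≤ l))
                                         (swapped-≤ {jStar n u i D} (<⇒≤ l)))
    ...   | no ne = before l ne (top-swapped refl ne (swapped-≤ {jStar n u i D} (<⇒≤ l)))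
                      (bottom-swapped refl (<⇒≢ l) (Eqs.not-starred refl (<⇒≤ l))
                                         (swapped-≤ {jStar n u i D} (<⇒≤ l)))
    classify c | tri> _ _ l = go (jStar n u i D) refl
      where
      go : ∀ js → jStar n u i D ≡ js → Column c
      go nothing e = kept l (Eqs.keptTop e l tt) (Eqs.keptBottom e l tt)
      go (just s) e with <-cmp c s
      ... | tri< lt _ _   = kept l (Eqs.keptTop e l lt) (Eqs.keptBottom e l lt)
      ... | tri≈ _ refl _ = star l (EqsJust.star-cov e) (EqsJust.afterTop e ≤-refl (c>b⇒c≢a l)) (EqsJust.starBottom e l)
      ... | tri> _ _ gt   = after l (EqsJust.afterTop e (<⇒≤ gt) (c>b⇒c≢a l)) (EqsJust.afterBottom e gt)

    passLeft : ∀ {r c} → r < k → c < u r → c < n → kind (D r c) ≡ pass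
    passLeft {r} {c} l l' l″ with kind (D r c) in eq
    ... | pass = refl
    ... | elb  = ⊥-elim (<⇒≱ l' (N.noneLeft (<-≤-trans l k≤n , l″ , inj₂ (kind-elb _ eq))))
    ... | piv  = ⊥-elim (<⇒≱ l' (N.noneLeft (<-≤-trans l k≤n , l″ , inj₁ (kind-piv _ eq))))

    top-vtx : ∀ {c} → IsVtx n D' i c → b ≤ c × (IsVtx n D i c ⊎ IsVtx n D (suc i) c)
    top-vtx {c} vx@(_ , c<n , t) with classify c
    ... | before l _ e _ = ⊥-elim (pass⇒¬vtx {W = D'} (trans (cong kind e) (passLeft i<k l c<n)) vx)
    ... | atA _ e _      = ⊥-elim (pass⇒¬vtx {W = D'} (cong kind e) vx)
    ... | atB e e' _     = ≤-reflexive (sym e) , inj₂ (vtx-transport {W = D} {W' = D'} e' i<n vx)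
    ... | kept l e _     = <⇒≤ l , inj₁ (vtx-transport {W = D} {W' = D'} e (<⇒≤ i<n) vx)
    ... | star l _ e _   = <⇒≤ l , inj₂ (vtx-transport {W = D} {W' = D'} e i<n vx)
    ... | after l e _    = <⇒≤ l , inj₂ (vtx-transport {W = D} {W' = D'} e i<n vx)

    bottom-vtx : ∀ {c} → IsVtx n D' (suc i) c → c ≢ b × (IsVtx n D i c ⊎ IsVtx n D (suc i) c)
    bottom-vtx {c} vx@(_ , c<n , t) with classify c
    ... | before l _ _ e = <⇒≢ l , inj₁ (vtx-transport {W = D} {W' = D'} e (<⇒≤ i<n) vx)
    ... | atA e' _ e     = (λ { refl → <⇒≢ a<b (sym e') }) , inj₁ (vtx-transport {W = D} {W' = D'} e (<⇒≤ i<n) vx)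
    ... | atB _ _ e      = ⊥-elim (pass⇒¬vtx {W = D'} (cong kind e) vx)
    ... | kept l _ e     = >⇒≢ l , inj₂ (vtx-transport {W = D} {W' = D'} e i<n vx)
    ... | star l (_ , t') _ _ = >⇒≢ l , inj₂ (i<n , c<n , t')
    ... | after l _ e    = >⇒≢ l , inj₁ (vtx-transport {W = D} {W' = D'} e (<⇒≤ i<n) vx)

    top-pivot-at : ∀ {c} → c < n → D' i c ≡ pivot → c ≡ b
    top-pivot-at {c} c<n t with classify c
    ... | before _ _ e _ = N.pivot⇒w i<k c<n (trans (sym e) t)
    ... | atA _ e _      = contradiction (trans (sym e) t) λ ()
    ... | atB e _ _      = e
    ... | kept l e _     = ⊥-elim (c>b⇒c≢a l (N.pivot⇒w i<k' c<n (trans (sym e) t)))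
    ... | star l _ e _   = N.pivot⇒w i<k c<n (trans (sym e) t)
    ... | after l e _    = N.pivot⇒w i<k c<n (trans (sym e) t)

    bottom-pivot-at : ∀ {c} → c < n → D' (suc i) c ≡ pivot → c ≡ a
    bottom-pivot-at {c} c<n t with classify c
    ... | before _ _ _ e = N.pivot⇒w i<k' c<n (trans (sym e) t)
    ... | atA e _ _      = e
    ... | atB _ _ e      = contradiction (trans (sym e) t) λ ()
    ... | kept l _ e     = ⊥-elim (>⇒≢ l (N.pivot⇒w i<k c<n (trans (sym e) t)))
    ... | star l _ _ e   = contradiction (trans (sym e) t) λ ()
    ... | after l _ e    = N.pivot⇒w i<k' c<n (trans (sym e) t)

    top-pivot≡ : D' i b ≡ pivot
    top-pivot≡ = trans (top-swapped refl (>⇒≢ a<b) (swapped-≤ {jStar n u i D} ≤-refl)) (N.pivotAt i<k)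

    bottom-pivot≡ : D' (suc i) a ≡ pivot
    bottom-pivot≡ = trans (bottom-swapped refl (<⇒≢ a<b) (Eqs.not-starred refl (<⇒≤ a<b))
                             (swapped-≤ {jStar n u i D} (<⇒≤ a<b))) (N.pivotAt i<k')

    -- `u` composed with the transposition of `i` and `suc i`, which gives the pivot columns of
    -- `D'`.
    w' : ℕ → ℕ
    w' = override i b (override (suc i) a u)

    w'-top : w' i ≡ b
    w'-top = override-≡ i b _

    w'-bottom : w' (suc i) ≡ a
    w'-bottom = trans (override-≢ i b _ 1+n≢n) (override-≡ (suc i) a u)

    w'-other : ∀ {r} → r ≢ i → r ≢ suc i → w' r ≡ u r
    w'-other p q = trans (override-≢ i b _ p) (override-≢ (suc i) a u q)

    byRow : ∀ (P : ℕ → Set) → P i → P (suc i) → (∀ {r} → r ≢ i → r ≢ suc i → P r) → ∀ r → P r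
    byRow P p q o r with r ≟ i | r ≟ suc i
    ... | yes refl | _        = p
    ... | no _     | yes refl = q
    ... | no ne    | no ne'   = o ne ne'

    old-vtx : ∀ {r c} → r ≢ i → r ≢ suc i → IsVtx n D' r c → IsVtx n D r c
    old-vtx {r} {c} p q vx@(l , _) = vtx-transport {W = D} {W' = D'} {r} {r} {c} (st-other p q) l vx

    network' : Network n k D' w'
    network' = record
      { k≤n       = k≤n
      ; inside    = λ {r} {c} → byRow (λ r → IsVtx n D' r c → r < k) (λ _ → i<k') (λ _ → i<k)
                                     (λ p q → N.inside ∘ old-vtx p q) r
      ; column<   = λ {r} → byRow (λ r → r < k → w' r < n) (λ _ → subst (_< n) (sym w'-top) b<n)
                                 (λ _ → subst (_< n) (sym w'-bottom) a<n)
                                 (λ p q l → subst (_< n) (sym (w'-other p q)) (N.column< l)) r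
      ; pivotAt   = λ {r} → byRow (λ r → r < k → D' r (w' r) ≡ pivot)
                                 (λ _ → subst (λ c → D' i c ≡ pivot) (sym w'-top) top-pivot≡)
                                 (λ _ → subst (λ c → D' (suc i) c ≡ pivot) (sym w'-bottom) bottom-pivot≡)
                                 (λ {r} p q l → subst (λ c → D' r c ≡ pivot) (sym (w'-other p q))
                                                  (trans (st-other p q) (N.pivotAt l))) r
      ; pivot⇒w   = λ {r} {c} → byRow (λ r → r < k → c < n → D' r c ≡ pivot → c ≡ w' r)
                                 (λ _ l e → trans (top-pivot-at l e) (sym w'-top))
                                 (λ _ l e → trans (bottom-pivot-at l e) (sym w'-bottom))
                                 (λ p q l l' e → trans (N.pivot⇒w l l' (trans (sym (st-other p q)) e))
                                                       (sym (w'-other p q))) r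
      ; noneLeft  = λ {r} {c} → byRow (λ r → IsVtx n D' r c → w' r ≤ c)
                                 (λ vx → subst (_≤ c) (sym w'-top) (proj₁ (top-vtx vx)))
                                 (λ vx → subst (_≤ c) (sym w'-bottom) (a≤ (proj₂ (bottom-vtx vx))))
                                 (λ p q vx → subst (_≤ c) (sym (w'-other p q)) (N.noneLeft (old-vtx p q vx))) r
      ; noneBelow = λ {r} {r'} l → below r l r'
      }
      where
      a≤ : ∀ {c} → IsVtx n D i c ⊎ IsVtx n D (suc i) c → a ≤ c
      a≤ (inj₁ vx) = N.noneLeft vx
      a≤ (inj₂ vx) = ≤-trans (<⇒≤ a<b) (N.noneLeft vx)
      neither : ∀ {r} → r < i → r < k → ¬ (IsVtx n D i (u r) ⊎ IsVtx n D (suc i) (u r))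
      neither l l' (inj₁ vx) = N.noneBelow l' l vx
      neither l l' (inj₂ vx) = N.noneBelow l' (m<n⇒m<1+n l) vx
      below : ∀ r → r < k → ∀ r' → r < r' → ¬ IsVtx n D' r' (w' r)
      below r l = byRow (λ r' → r < r' → ¬ IsVtx n D' r' (w' r))
        (λ lt vx → neither lt l (subst (λ c → IsVtx n D i c ⊎ IsVtx n D (suc i) c)
                     (w'-other (<⇒≢ lt) (<⇒≢ (m<n⇒m<1+n lt))) (proj₂ (top-vtx vx))))
        (λ lt → second (m≤n⇒m<n∨m≡n (s≤s⁻¹ lt)))
        (λ {r'} p q lt vx → byRow (λ r → r < k → r < r' → ¬ IsVtx n D r' (w' r))
           (λ _ lt vx → N.noneBelow i<k (≤∧≢⇒< lt (q ∘ sym)) (subst (IsVtx n D r') w'-top vx))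
           (λ _ lt vx → N.noneBelow i<k' (<⇒≤ lt) (subst (IsVtx n D r') w'-bottom vx))
           (λ p q l lt vx → N.noneBelow l lt (subst (IsVtx n D r') (w'-other p q) vx)) r l lt (old-vtx p q vx))
        where
        second : r < i ⊎ r ≡ i → ¬ IsVtx n D' (suc i) (w' r)
        second (inj₁ lt) vx = neither lt l (subst (λ c → IsVtx n D i c ⊎ IsVtx n D (suc i) c)
                                (w'-other (<⇒≢ lt) (<⇒≢ (m<n⇒m<1+n lt))) (proj₂ (bottom-vtx vx)))
        -- The lower box of column `b` has become a horizontal pipe, so the pivot moved up to row
        -- `i` has no vertex directly below it.
        second (inj₂ refl) vx = proj₁ (bottom-vtx vx) w'-top

    -- The column shapes of rows i and i+1

    module Profile {W : Grid} {J : Subset n} (F : Flow n k W J)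
                   (agreeW : ∀ {r c} → suc (suc i) ≤ r → r < k → c < n → W r c ≡ D r c) where
      open Flow F using () renaming (v to flow-v)
      open FlowScan F using (vertexBelow)
      open Coloops fpp k≤n F (suc (suc i)) (λ l l' l″ → trans (agreeW l l' l″) (D≡E l' l″))
        using (crossing⇒coloop; toE)
      open TwoRows (kind ∘ D i) (kind ∘ D (suc i)) (kind ∘ D' i) (kind ∘ D' (suc i))
                   (flow-v (suc (suc i))) (flow-v i) n

      -- An input from below needs a vertex further down in column `c`, and with it
      -- `crossing⇒coloop` applies to the cross in row `suc i`. `W` may be either array, since the
      -- two agree from row `suc (suc i)` on.
      forcing : ∀ {c} → c < n → E (suc i) c ≡ cross → Forcing c
      forcing {c} c<n cr sc c' l c'<n el gap =
        crossing⇒coloop ≤-refl i<k cr l c'<n (trans (sym (D≡E i<k c'<n)) (kind-elb _ el))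
          (λ d l l' vx → pass⇒¬vtx {W = D} (gap d l l') (vtxD i<k vx))
          (let r , l , l' , vx = vertexBelow (k ∸ suc (suc i)) (suc (suc i)) (m+[n∸m]≡n i<k) k≤n c<n sc
           in r , l , l' , toE l l' vx)

      -- Right of `b` a column has its pivot above both rows or below both, so horizontal pipes come
      -- in pairs; a cross above an elbow is the pattern that defines j*.
      shape : ∀ {c} → b < c → c < n → ¬ CrossOverVtx D i c → Shape c
      shape {c} b<c c<n nc with cell {suc i} i<n c<n
      ... | emptyLeft _ l _ = ⊥-elim (<-asym b<c l)
      ... | vertLeft _ l _  = ⊥-elim (<-asym b<c l)
      ... | atPivot e _     = ⊥-elim (>⇒≢ b<c e)
      ... | horizRight (i' , s≤s l , e) _ t with m≤n⇒m<n∨m≡n l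
      ...   | inj₂ refl = ⊥-elim (c>b⇒c≢a b<c (sym e))
      ...   | inj₁ lt = pass-pass
        (cong kind (trans (D≡E i<k' c<n) (proj₁ (proj₂ tiles) i c (<⇒≤ i<n) c<n (i' , lt , e) (<-trans a<b b<c))))
        (cong kind (trans (D≡E i<k c<n) t))
      shape {c} b<c c<n nc | crossRight (i' , l , l' , e) _ t
        with proj₂ (proj₂ (proj₂ tiles)) i c (<⇒≤ i<n) c<n (i' , <⇒≤ l , l' , e) (<-trans a<b b<c)
      ...   | inj₁ t' = pass-pass (cong kind (trans (D≡E i<k' c<n) t')) (cong kind (trans (D≡E i<k c<n) t))
      ...   | inj₂ t' = elb-pass (cong kind (trans (D≡E i<k' c<n) t')) (cong kind (trans (D≡E i<k c<n) t))
                                 (forcing c<n t)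
      shape {c} b<c c<n nc | elbowRight (i' , l , l' , e) _ t
        with proj₂ (proj₂ (proj₂ tiles)) i c (<⇒≤ i<n) c<n (i' , <⇒≤ l , l' , e) (<-trans a<b b<c)
      ...   | inj₁ t' = ⊥-elim (nc (trans (D≡E i<k' c<n) t' , inj₂ (trans (D≡E i<k c<n) t)))
      ...   | inj₂ t' = elb-elb (cong kind (trans (D≡E i<k' c<n) t')) (cong kind (trans (D≡E i<k c<n) t))

      bound : ∀ {m c} → c + suc m ≡ n → c < n
      bound {m} {c} e = subst (c <_) e (m<m+n c (s≤s z≤n))

      module _ {s : ℕ} (js : jStar n u i D ≡ just s) where
        open EqsJust js

        -- The cross at j* lies above a vertex, so `noElbowRightOfCross` clears the rest of the
        -- upper row, and the pivot of that row lies further left. Hence exchanging the tails of the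
        -- rows moves vertices of one row only.
        top-pass : ∀ {c} → s < c → c < n → kind (D i c) ≡ pass
        top-pass {c} l c<n with kind (D i c) in eq
        ... | pass = refl
        ... | piv  = ⊥-elim (c>b⇒c≢a (≤-<-trans b≤star l) (N.pivot⇒w i<k' c<n (kind-piv _ eq)))
        ... | elb  = ⊥-elim (noElbowRightOfCross i<n (trans (sym (D≡E i<k' star<n)) (proj₁ star-cov))
                               (vtxE i<k (i<n , star<n , proj₂ star-cov)) (suc c) c l
                               (≤-trans ≤-refl (m≤n+m (suc c) s)) c<n
                               (trans (sym (D≡E i<k' c<n)) (kind-elb _ eq)))

        late : ∀ m c → c + m ≡ n → s < c → Late m c
        late zero c e l = end
        late (suc m) c e l = swap p (trans (cong kind (afterBottom l)) p)
          (cong kind (afterTop (<⇒≤ l) (c>b⇒c≢a (≤-<-trans b≤star l)))) (late m (suc c) (shift e) (m<n⇒m<1+n l))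
          where p = top-pass l (bound e)

        star-elb : b < s → kind (D (suc i) s) ≡ elb
        star-elb l with proj₂ star-cov
        ... | inj₁ t = ⊥-elim (>⇒≢ l (N.pivot⇒w i<k star<n t))
        ... | inj₂ t = cong kind t

        middle-before : ∀ m c → c + m ≡ n → b < c → c ≤ s → Middle m c
        middle-before zero c _ _ _ = end
        middle-before (suc m) c e l l' with m≤n⇒m<n∨m≡n l'
        ... | inj₁ lt = keep (cong kind (keptTop l lt)) (cong kind (keptBottom l lt))
                          (shape l (bound e) (before-cov (<⇒≤ l) (bound e) lt))
                          (middle-before m (suc c) (shift e) (m<n⇒m<1+n l) lt)
        ... | inj₂ refl = star (cong kind (proj₁ star-cov)) (star-elb l)
                            (trans (cong kind (afterTop ≤-refl (c>b⇒c≢a l))) (star-elb l))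
                            (cong kind (starBottom l)) (late m (suc c) (shift e) ≤-refl)

      middle-∞ : jStar n u i D ≡ nothing → ∀ m c → c + m ≡ n → b < c → Middle m c
      middle-∞ js zero c _ _ = end
      middle-∞ js (suc m) c e l =
        keep (cong kind (Eqs.keptTop js l tt)) (cong kind (Eqs.keptBottom js l tt))
             (shape l (bound e) (Eqs.before-cov js (<⇒≤ l) (bound e) tt))
             (middle-∞ js m (suc c) (shift e) (m<n⇒m<1+n l))

      -- The box above the lower pivot decides: a cross makes `b` itself j*, and an elbow opens a
      -- middle zone in which a lag is possible.
      at-pivot : ∀ m → b + suc m ≡ n → Early (suc m) b
      at-pivot m e with proj₂ (proj₂ (proj₂ tiles)) i b (<⇒≤ i<n) b<n (suc i , ≤-refl , i<n , refl) a<b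
      ... | inj₂ t = turn x-elb y-piv (cong kind top-pivot≡) (cong kind (bottom-pivot refl refl))
                            (go (jStar n u i D) refl)
        where
        x-elb = cong kind (trans (D≡E i<k' b<n) t)
        y-piv = cong kind (N.pivotAt i<k)
        go : ∀ js → jStar n u i D ≡ js → Middle m (suc b)
        go nothing js = middle-∞ js m (suc b) (shift e) ≤-refl
        go (just s) js with m≤n⇒m<n∨m≡n (EqsJust.b≤star js)
        ... | inj₁ lt   = middle-before js m (suc b) (shift e) ≤-refl lt
        ... | inj₂ refl = contradiction (trans (sym x-elb) (cong kind (proj₁ (EqsJust.star-cov js)))) λ ()
      ... | inj₁ t = turnStar (cong kind x-cross) (cong kind (N.pivotAt i<k)) (cong kind top-pivot≡)
                       (cong kind (bottom-pivot refl refl)) (go (jStar n u i D) refl)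
        where
        x-cross = trans (D≡E i<k' b<n) t
        go : ∀ js → jStar n u i D ≡ js → Late m (suc b)
        go nothing js = ⊥-elim (Eqs.before-cov js ≤-refl b<n tt (x-cross , inj₁ (N.pivotAt i<k)))
        go (just s) js with m≤n⇒m<n∨m≡n (EqsJust.b≤star js)
        ... | inj₁ lt   = ⊥-elim (Eqs.before-cov js ≤-refl b<n lt (x-cross , inj₁ (N.pivotAt i<k)))
        ... | inj₂ refl = late js m (suc b) (shift e) ≤-refl

      early : ∀ m c → c + m ≡ n → c ≤ b → Early m c
      early zero c e l = ⊥-elim (<⇒≱ b<n (subst (_≤ b) (trans (sym (+-identityʳ c)) e) l))
      early (suc m) c e l with m≤n⇒m<n∨m≡n l
      ... | inj₂ refl = at-pivot m e
      ... | inj₁ lt with classify c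
      ...   | before _ _ p q = swap y-pass (trans (cong kind p) y-pass) (cong kind q) (early m (suc c) (shift e) lt)
        where y-pass = passLeft i<k lt (bound e)
      ...   | atA _ p q   = swap (passLeft i<k lt (bound e)) (cong kind p) (cong kind q) (early m (suc c) (shift e) lt)
      ...   | atB p _ _   = ⊥-elim (<⇒≢ lt p)
      ...   | kept l' _ _ = ⊥-elim (<-asym lt l')
      ...   | star l' _ _ _ = ⊥-elim (<-asym lt l')
      ...   | after l' _ _ = ⊥-elim (<-asym lt l')

      standardized : Run₁ n 0 false false → Run₂ n 0 false false
      standardized = early-to refl (early n 0 refl z≤n)

      unstandardized : Run₂ n 0 false false → Run₁ n 0 false false
      unstandardized = early-from refl (early n 0 refl z≤n)

    rowRun : ∀ {W J} (F : Flow n k W J) →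
             Run (kind ∘ W i) (kind ∘ W (suc i)) (Flow.v F (suc (suc i))) (Flow.v F i) n 0 false false
    rowRun F = subst₂ (Run _ _ _ _ n 0) (Flow.leftEnd F i<k') (Flow.leftEnd F i<k) (flow⇒run F i<k n 0 refl)

    flow-to : ∀ {J} → Flow n k D J → Flow n k D' J
    flow-to F = ReplaceRows.replaced F i<k st-other (Profile.standardized F (λ _ _ _ → refl) (rowRun F))

    flow-from : ∀ {J} → Flow n k D' J → Flow n k D J
    flow-from F = ReplaceRows.replaced F i<k (λ p q → sym (st-other p q))
      (Profile.unstandardized F (λ l _ _ → st-other (>⇒≢ (<⇒≤ l)) (>⇒≢ l)) (rowRun F))

    exchange : ∀ J → InB n D k J ⇔ InB n D' k J
    exchange J = mk⇔
      (λ x → let size , F = to (InB⇔Flow network J) x in from (InB⇔Flow network' J) (size , flow-to F))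
      (λ x → let size , F = to (InB⇔Flow network' J) x in from (InB⇔Flow network J) (size , flow-from F))
      where open Equivalence

theorem4p34 : ∀ (n k : ℕ) (u : ℕ → ℕ) (D : Grid) → IsPartialFPP n k u D →
    ∀ (i : ℕ) → suc i < k → u i < u (suc i) →
    ∀ (J : Subset n) → InB n D k J ⇔ InB n (st n u i D) k J
theorem4p34 n k u D (k≤n , v , E , fpp , agree) i i<k a<b = Partial.Exchange.exchange k≤n fpp agree i<k a<b
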